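{- Let $k$ be a number field and let $C$ be an algebraic curve defined over $k$ by $z^2=f(x,y)$, where $f\in k[x,y]$ is homogeneous with $\deg(f)\ge 2$. Then there exists an infinite quadratic geometric progression sequence on $C$, and there exists an infinite quadratic arithmetic progression sequence on $C$.
   Context: $k$ is a number field with fixed algebraic closure $\overline{k}$. Only points of $C$ in the affine chart $y=1$ are needed: for a field $\ell$ with $k\subseteq \ell\subseteq\overline{k}$, a point $(x,1,z)$ of $C$ over $\ell$ is a pair $x,z\in \ell$ with $z^2=f(x,1)$. The set of quadratic points is $\Gamma_2(C,k)=\bigcup_{[\ell:k]=2}C(\ell)$, the union being over all quadratic extensions $\ell/k$ inside $\overline{k}$ (in particular it contains the $k$-rational points). A quadratic geometric progression sequence on $C$ is a sequence of points $P_i=(x_i,1,z_i)\in \Gamma_2(C,k)$, $i=1,2,\ldots$, with $x_i\in k$, such that there exist $t,t'\in k^*$ with $x_i=t't^i$ for all $i$. A quadratic arithmetic progression sequence on $C$ is a sequence of points $P_i=(x_i,1,z_i)\in\Gamma_2(C,k)$, $i=1,2,\ldots$, with $x_i\in k$, such that there exist $t,t'\in k^*$ with $x_i=t'+it$ for all $i$. Progressions are regarded as sets of points: such a sequence is called infinite if it is indexed by all positive integers and contains infinitely many distinct points $P_i$, and finite otherwise. -}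

module Defs where

open import Level using (Level; _⊔_; suc; 0ℓ)
open import Algebra.Apartness.Bundles using (HeytingField; HeytingCommutativeRing)
open import Algebra.Bundles using (CommutativeRing; RawRing)
open import Algebra.Morphism.Structures using (module RingMorphisms)
import Algebra.Definitions.RawSemiring as RawSemiringDefinitions
open import Data.Fin.Base using (Fin; toℕ; fromℕ)
open import Data.Nat.Base as ℕ using (ℕ)
open import Data.Product.Base using (∃; ∃₂; _×_)
import Data.Rational.Properties as ℚ
open import Data.Vec.Functional using (Vector)
open import Function.Base using (_∘_)
open import Function.Definitions using (Injective)
open import Relation.Binary.Core using (Rel)
open import Relation.Binary.PropositionalEquality.Core using (_≡_)
open import Relation.Unary using (Pred; _∈_; U)

private
  variable
    a a₁ a₂ c ℓ₁ ℓ₂ : Level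

-- Fields are the library's Heyting fields. The relation x # y holds exactly
-- when x - y is invertible, and it is tight; under excluded middle it is
-- therefore the negation of x ≈ y, and these are precisely the fields of
-- classical algebra. In particular t # 0# expresses t ∈ k*.
module FieldOps (F : HeytingField c ℓ₁ ℓ₂) where
  open HeytingField F public
    using (Carrier; _≈_; _#_; _+_; _*_; -_; 0#; 1#)

  open CommutativeRing
    (HeytingCommutativeRing.commutativeRing (HeytingField.heytingCommutativeRing F))
    public using (rawRing)

  open RawSemiringDefinitions (RawRing.rawSemiring rawRing) public
    using (_^_; sum) renaming (_×_ to _·_)

  -- The value at x of the polynomial p₀ + p₁ X + ⋯ .
  evaluate : ∀ {n} → Vector Carrier n → Carrier → Carrier
  evaluate p x = sum λ i → p i * x ^ toℕ i

ℚ-field : HeytingField 0ℓ 0ℓ 0ℓ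
ℚ-field = ℚ.heytingField

record Extension (F : HeytingField a a₁ a₂) (E : HeytingField c ℓ₁ ℓ₂) :
                 Set (a ⊔ a₁ ⊔ c ⊔ ℓ₁) where
  private
    module F = FieldOps F
    module E = FieldOps E
  open RingMorphisms F.rawRing E.rawRing using (IsRingHomomorphism)
  field
    ι                  : F.Carrier → E.Carrier
    isRingHomomorphism : IsRingHomomorphism ι

module _ {F : HeytingField a a₁ a₂} {E : HeytingField c ℓ₁ ℓ₂}
         (F⊆E : Extension F E) where
  private
    module F = FieldOps F
    module E = FieldOps E
  open Extension F⊆E

  combination : ∀ {n} → Vector F.Carrier n → Vector E.Carrier n → E.Carrier
  combination s b = E.sum λ i → ι (s i) E.* b i

  record IsBasis {p} (V : Pred E.Carrier p) {n : ℕ} (b : Vector E.Carrier n) :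
                 Set (a ⊔ a₁ ⊔ c ⊔ ℓ₁ ⊔ p) where
    field
      member      : ∀ i → b i ∈ V
      spanning    : ∀ {v} → v ∈ V → ∃ λ s → v E.≈ combination s b
      independent : ∀ s → combination s b E.≈ E.0# → ∀ i → s i F.≈ F.0#

  -- dim_F V = n, for an F-subspace V of E.
  HasDimension : ∀ {p} → Pred E.Carrier p → ℕ → Set (a ⊔ a₁ ⊔ c ⊔ ℓ₁ ⊔ p)
  HasDimension V n = ∃ λ (b : Vector E.Carrier n) → IsBasis V b

  record IsIntermediateField {p} (L : Pred E.Carrier p) :
                             Set (a ⊔ c ⊔ ℓ₁ ⊔ p) where
    field
      respects-≈ : ∀ {u v} → u E.≈ v → u ∈ L → v ∈ L
      contains-F : ∀ s → ι s ∈ L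
      +-closed   : ∀ {u v} → u ∈ L → v ∈ L → (u E.+ v) ∈ L
      *-closed   : ∀ {u v} → u ∈ L → v ∈ L → (u E.* v) ∈ L
      neg-closed : ∀ {u} → u ∈ L → (E.- u) ∈ L
      inv-closed : ∀ {u v} → u ∈ L → (u E.* v) E.≈ E.1# → v ∈ L

  record IsAlgebraicClosure : Set (a ⊔ a₂ ⊔ c ⊔ ℓ₁ ⊔ ℓ₂) where
    field
      algebraic : ∀ u → ∃₂ λ n (p : Vector F.Carrier n) →
                  (∃ λ i → p i F.# F.0#) × E.evaluate (ι ∘ p) u E.≈ E.0#
      -- p ranges over the polynomials of degree exactly n + 1.
      closed    : ∀ {n} (p : Vector E.Carrier (ℕ.suc (ℕ.suc n))) →
                  p (fromℕ (ℕ.suc n)) E.# E.0# →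
                  ∃ λ u → E.evaluate p u E.≈ E.0#

record IsNumberField (k : HeytingField c ℓ₁ ℓ₂) : Set (c ⊔ ℓ₁) where
  field
    ℚ⊆k          : Extension ℚ-field k
    finiteDegree : ∃ λ n → HasDimension ℚ⊆k U n

-- An element of k[x,y] is Σ coeff i j x^i y^j with i , j < bound.
record Polynomial₂ (k : HeytingField c ℓ₁ ℓ₂) : Set c where
  open FieldOps k
  field
    bound : ℕ
    coeff : Fin bound → Fin bound → Carrier

-- The nonvanishing clause excludes the zero polynomial, so that d is deg f.
record IsHomogeneousOfDegree {k : HeytingField c ℓ₁ ℓ₂}
                             (d : ℕ) (f : Polynomial₂ k) : Set ℓ₂ where
  open FieldOps k
  open Polynomial₂ f
  field
    nonzero     : ∃₂ λ i j → coeff i j # 0#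
    homogeneous : ∀ i j → coeff i j # 0# → toℕ i ℕ.+ toℕ j ≡ d

module Curve {k K : HeytingField c ℓ₁ ℓ₂} (k⊆K : Extension k K)
             (f : Polynomial₂ k) where
  private
    module k = FieldOps k
    module K = FieldOps K
  open Extension k⊆K
  open Polynomial₂ f

  value : K.Carrier → K.Carrier → K.Carrier
  value x y = K.sum λ i → K.sum λ j →
    ι (coeff i j) K.* (x K.^ toℕ i K.* y K.^ toℕ j)

  -- The triple (x , 1 , z).
  record Point : Set c where
    constructor [_,1,_]
    field
      x z : K.Carrier

  open Point

  _≈ₚ_ : Rel Point ℓ₁
  P ≈ₚ Q = (x P K.≈ x Q) × (z P K.≈ z Q)

  record C⟨_⟩ {p} (L : Pred K.Carrier p) (P : Point) : Set (ℓ₁ ⊔ p) where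
    field
      x∈L     : x P ∈ L
      z∈L     : z P ∈ L
      onCurve : (z P K.^ 2) K.≈ value (x P) K.1#

  record Γ₂ (P : Point) : Set (suc (c ⊔ ℓ₁)) where
    field
      L                   : Pred K.Carrier (c ⊔ ℓ₁)
      isIntermediateField : IsIntermediateField k⊆K L
      quadratic           : HasDimension k⊆K L 2
      P∈C⟨L⟩              : P ∈ C⟨ L ⟩

  -- Sequences are indexed by i = 1, 2, …; P n is the point with i = n + 1.
  record IsQuadraticGeometricProgression (P : ℕ → Point) :
                                         Set (suc (c ⊔ ℓ₁) ⊔ ℓ₂) where
    field
      quadraticPoint : ∀ n → P n ∈ Γ₂
      x∈k            : ∀ n → ∃ λ s → x (P n) K.≈ ι s
      t t′           : k.Carrier
      t#0            : t k.# k.0#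
      t′#0           : t′ k.# k.0#
      progression    : ∀ n → x (P n) K.≈ ι (t′ k.* t k.^ ℕ.suc n)

  record IsQuadraticArithmeticProgression (P : ℕ → Point) :
                                          Set (suc (c ⊔ ℓ₁) ⊔ ℓ₂) where
    field
      quadraticPoint : ∀ n → P n ∈ Γ₂
      x∈k            : ∀ n → ∃ λ s → x (P n) K.≈ ι s
      t t′           : k.Carrier
      t#0            : t k.# k.0#
      t′#0           : t′ k.# k.0#
      progression    : ∀ n → x (P n) K.≈ ι (t′ k.+ ℕ.suc n k.· t)

  -- Among the terms of P there are m pairwise distinct points, for every m.
  Infinite : (ℕ → Point) → Set ℓ₁
  Infinite P = ∀ m → ∃ λ (s : Fin m → ℕ) → Injective _≡_ _≈ₚ_ (P ∘ s)

{-# OPTIONS --safe #-}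
-- For x in k let v = f(x, 1). A square root z of v either generates a quadratic
-- extension of k, or lies in k and hence in every quadratic extension of k. So
-- every x in k is the abscissa of a quadratic point as soon as k has a quadratic
-- extension, and since k has characteristic zero the abscissas 2 · 2ⁱ and
-- 1 + i are infinitely many.
--
-- If every element of k were a square, some r in k would satisfy r ^ N = 2 with N = 2ⁿ
-- larger than n = [k : ℚ]. Then 1, r, …, rⁿ satisfy an integer relation with
-- some odd coefficient, and reading it modulo 2 = r ^ N shows that r is
-- invertible in the ring ℤ[r]. Hence 2 is a unit of ℤ[r], so 1 is divisible there by
-- every power of 2; but ℤ[r] has bounded denominators with respect to a
-- ℚ-basis of k.
module Submission where

open import Defs
open import Level using (Level; _⊔_; Lift; lift; lower)
open import Algebra.Apartness.Bundles using (HeytingField; HeytingCommutativeRing)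
import Algebra.Apartness.Properties.HeytingCommutativeRing as HeytingProperties
open import Algebra.Bundles using (CommutativeRing)
import Algebra.Morphism.Construct.Composition as Composition
open import Algebra.Morphism.Structures using (module RingMorphisms)
import Algebra.Properties.Ring as RingProperties
import Algebra.Properties.Semiring.Exp as SemiringExp
import Algebra.Properties.Semiring.Sum as SemiringSum
import Algebra.Solver.Ring as RingSolver
open import Algebra.Solver.Ring.AlmostCommutativeRing using
  (fromCommutativeRing; _-Raw-AlmostCommutative⟶_)
open import Axiom.ExcludedMiddle using (ExcludedMiddle)
open import Data.Fin.Base as Fin using (Fin; toℕ; fromℕ<; punchIn)
open import Data.Fin.Patterns using (0F; 1F)
import Data.Fin.Properties as Fin
import Data.Integer.DivMod as ℤ
open import Data.Integer.Base as ℤ using (ℤ; +_; -[1+_]; 0ℤ; 1ℤ; ∣_∣)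
import Data.Integer.Properties as ℤ
import Data.Integer.Tactic.RingSolver as ℤ-RingSolver
open import Data.Maybe.Base using (Maybe; just; nothing)
open import Data.Nat.Base as ℕ using (ℕ; zero; suc; _<_; _≤_; z≤n; s≤s)
open import Data.Nat.Induction using (<-wellFounded)
import Data.Nat.Properties as ℕ
open import Data.Product.Base using (Σ-syntax; ∃; ∃₂; _×_; _,_; proj₁; proj₂)
open import Data.Rational.Base as ℚ using (ℚ; 0ℚ; 1ℚ; ½; toℚᵘ; ↥_; ↧_)
import Data.Rational.Properties as ℚ
open import Data.Rational.Unnormalised.Base as ℚᵘ using (mkℚᵘ; *≡*) renaming (_≃_ to _≃ᵘ_)
import Data.Rational.Unnormalised.Properties as ℚᵘ
open import Data.Sum.Base using (_⊎_; inj₁; inj₂; [_,_]′)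
open import Data.Vec.Functional using (Vector; []; _∷_; insertAt)
open import Data.Vec.Functional.Properties using (insertAt-lookup; insertAt-punchIn)
open import Function.Base using (_∘_)
open import Induction.WellFounded using (Acc; acc)
open import Relation.Binary.Definitions using (tri<; tri≈; tri>)
open import Relation.Binary.PropositionalEquality as ≡ using (_≡_; _≢_)
import Relation.Binary.Reasoning.Setoid as SetoidReasoning
open import Relation.Nullary using (¬_; Dec; yes; no; contradiction; ¬?)
open import Relation.Nullary.Decidable as Dec using (decidable-stable)
open import Relation.Unary using (Pred)

private
  variable
    a κ ℓ ℓ₁ ℓ₂ : Level

-- Linear relations over an integral domain

module LinearRelations (R : CommutativeRing a ℓ) where
  open CommutativeRing R hiding (zero)
  open RingProperties ring using (-‿distribˡ-*; -‿distribʳ-*; x[y-z]≈xy-xz)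
  open SemiringSum semiring
  open SetoidReasoning setoid

  IsRelation : ∀ {m n} → Vector Carrier m → (Fin m → Vector Carrier n) → Set ℓ
  IsRelation c v = ∀ j → sum (λ i → c i * v i j) ≈ 0#

  sum-zero : ∀ {n} (t : Vector Carrier n) → (∀ i → t i ≈ 0#) → sum t ≈ 0#
  sum-zero {n} t t≈0 = trans (sum-cong-≋ t≈0) (sum-replicate-zero n)

  module _ (noZeroDivisors : ∀ x y → x * y ≈ 0# → (x ≈ 0#) ⊎ (y ≈ 0#)) where

    -- The common factor `x` comes out of every column sum, and in a domain it can be cancelled
    -- there. With `x` equal to 2 this halves a relation whose coefficients are all even.
    IsRelation-cancel : ∀ {m n} {c d : Vector Carrier m} {v : Fin m → Vector Carrier n} {x} →
      ¬ x ≈ 0# → (∀ i → c i ≈ x * d i) → IsRelation c v → IsRelation d v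
    IsRelation-cancel {c = c} {d} {v} {x} x≉0 c≈xd rel j =
      [ (λ x≈0 → contradiction x≈0 x≉0) , (λ eq → eq) ]′ (noZeroDivisors x _ (begin
        x * sum (λ i → d i * v i j)    ≈⟨ *-distribˡ-sum x (λ i → d i * v i j) ⟩
        sum (λ i → x * (d i * v i j))  ≈⟨ sum-cong-≋ (λ i →
                                            trans (sym (*-assoc x (d i) (v i j)))
                                                  (*-congʳ (sym (c≈xd i)))) ⟩
        sum (λ i → c i * v i j)        ≈⟨ rel j ⟩
        0#                             ∎))

    -- Gaussian elimination without division: the rows other than the pivot
    -- row are replaced by combinations with vanishing first entry.
    linearRelation : 1# ≉ 0# → (∀ x → Dec (x ≈ 0#)) → ∀ n (v : Fin (suc n) → Vector Carrier n) →
      Σ[ c ∈ Vector Carrier (suc n) ] (∃ λ i → c i ≉ 0#) × IsRelation c v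
    linearRelation 1≉0 _  zero    v = (λ _ → 1#) , (Fin.zero , 1≉0) , λ ()
    linearRelation 1≉0 ≟0 (suc n) v with Fin.any? (λ i → ¬? (≟0 (v i Fin.zero)))
    -- The first column is zero and imposes no condition, so row 0 may be discarded with coefficient
    -- `0#` and the other rows handled on the remaining columns.
    ... | no ∄pivot = 0# ∷ c , (Fin.suc i , cᵢ≉0) , λ
        { Fin.zero    → sum-zero (λ i → (0# ∷ c) i * v i Fin.zero) λ i →
            trans (*-congˡ (decidable-stable (≟0 (v i Fin.zero)) λ vᵢ≉0 → ∄pivot (i , vᵢ≉0)))
                  (zeroʳ _)
        ; (Fin.suc j) → trans (+-congʳ (zeroˡ _)) (trans (+-identityˡ _) (rel j))
        }
      where
      ih = linearRelation 1≉0 ≟0 n (λ i → v (Fin.suc i) ∘ Fin.suc)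
      c : Vector Carrier (suc n)
      c = proj₁ ih
      i = proj₁ (proj₁ (proj₂ ih))
      cᵢ≉0 = proj₂ (proj₁ (proj₂ ih))
      rel = proj₂ (proj₂ ih)
    ... | yes (p , vₚ≉0) = c , (punchIn p i , cᵢ≉0) , λ
        -- In column 0 each reduced entry is `pivot * first i - first i * pivot`, hence zero.
        { Fin.zero    → trans (column Fin.zero) (sum-zero (λ i → c′ i * reduced i Fin.zero) λ i →
            trans (*-congˡ (trans (+-congʳ (*-comm _ _)) (-‿inverseʳ _))) (zeroʳ _))
        ; (Fin.suc j) → trans (column (Fin.suc j)) (rel j)
        }
      where
      pivot = v p Fin.zero

      first : Vector Carrier (suc n)
      first i = v (punchIn p i) Fin.zero

      reduced : Fin (suc n) → Vector Carrier (suc n)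
      reduced i j = pivot * v (punchIn p i) j - first i * v p j

      ih = linearRelation 1≉0 ≟0 n (λ i → reduced i ∘ Fin.suc)
      c′ : Vector Carrier (suc n)
      c′ = proj₁ ih
      i = proj₁ (proj₁ (proj₂ ih))
      c′ᵢ≉0 = proj₂ (proj₁ (proj₂ ih))
      rel = proj₂ (proj₂ ih)
      S = sum (λ i → c′ i * first i)

      -- Expanding `c′ i * reduced i j` leaves `c′ i * pivot` on the row `punchIn p i`, and the
      -- subtracted multiples of the pivot row add up to `- S`.
      c : Vector Carrier (suc (suc n))
      c = insertAt (λ i → c′ i * pivot) p (- S)

      c-punchIn : ∀ i → c (punchIn p i) ≈ c′ i * pivot
      c-punchIn i = reflexive (insertAt-punchIn (λ i → c′ i * pivot) p (- S) i)

      cᵢ≉0 : c (punchIn p i) ≉ 0#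
      cᵢ≉0 eq = [ c′ᵢ≉0 , vₚ≉0 ]′
        (noZeroDivisors (c′ i) pivot (trans (sym (c-punchIn i)) eq))

      term : ∀ c f x q y → c * f * - x + c * q * y ≈ c * (q * y - f * x)
      term c f x q y = begin
        c * f * - x + c * q * y        ≈⟨ +-comm _ _ ⟩
        c * q * y + c * f * - x        ≈⟨ +-cong (*-assoc c q y)
                                            (trans (sym (-‿distribʳ-* (c * f) x))
                                                   (-‿cong (*-assoc c f x))) ⟩
        c * (q * y) - c * (f * x)      ≈⟨ x[y-z]≈xy-xz c (q * y) (f * x) ⟨
        c * (q * y - f * x)            ∎

      column : ∀ j → sum (λ i → c i * v i j) ≈ sum (λ i → c′ i * reduced i j)
      column j = begin
        sum (λ i → c i * v i j)
          ≈⟨ sum-remove {i = p} (λ i → c i * v i j) ⟩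
        c p * v p j + sum (λ i → c (punchIn p i) * v (punchIn p i) j)
          ≈⟨ +-cong (*-congʳ (reflexive (insertAt-lookup (λ i → c′ i * pivot) p (- S))))
                    (sum-cong-≋ λ i → *-congʳ {x = v (punchIn p i) j} (c-punchIn i)) ⟩
        - S * v p j + sum (λ i → c′ i * pivot * v (punchIn p i) j)
          ≈⟨ +-congʳ (trans (sym (-‿distribˡ-* S (v p j))) (trans (-‿distribʳ-* S (v p j))
               (*-distribʳ-sum (- v p j) (λ i → c′ i * first i)))) ⟩
        sum (λ i → c′ i * first i * - v p j) + sum (λ i → c′ i * pivot * v (punchIn p i) j)
          ≈⟨ ∑-distrib-+ (λ i → c′ i * first i * - v p j)
                         (λ i → c′ i * pivot * v (punchIn p i) j) ⟨
        sum (λ i → c′ i * first i * - v p j + c′ i * pivot * v (punchIn p i) j)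
          ≈⟨ sum-cong-≋ (λ i →
               term (c′ i) (first i) (v p j) pivot (v (punchIn p i) j)) ⟩
        sum (λ i → c′ i * reduced i j) ∎

-- Parity, and integer relations with an odd coefficient

Odd : ℤ → Set
Odd z = ∃ λ q → z ≡ 1ℤ ℤ.+ + 2 ℤ.* q

Even : ℤ → Set
Even z = ∃ λ q → z ≡ + 2 ℤ.* q

parity : ∀ z → Even z ⊎ Odd z
parity z with z ℤ.%ℕ 2 | z ℤ./ℕ 2 | ℤ.n%ℕd<d z 2 | ℤ.a≡a%ℕn+[a/ℕn]*n z 2
... | 0 | q | _ | eq = inj₁ (q , ≡.trans eq (≡.trans (ℤ.+-identityˡ _) (ℤ.*-comm q (+ 2))))
... | 1 | q | _ | eq = inj₂ (q , ≡.trans eq (≡.cong (λ x → 1ℤ ℤ.+ x) (ℤ.*-comm q (+ 2))))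
... | suc (suc _) | _ | s≤s (s≤s ()) | _

someOdd : ∀ {n} (c : Vector ℤ n) → (∃ λ i → Odd (c i)) ⊎ (∀ i → Even (c i))
someOdd {zero}  c = inj₂ λ ()
someOdd {suc n} c with parity (c Fin.zero) | someOdd (c ∘ Fin.suc)
... | inj₂ odd | _              = inj₁ (Fin.zero , odd)
... | inj₁ _   | inj₁ (i , odd) = inj₁ (Fin.suc i , odd)
... | inj₁ e   | inj₂ even      = inj₂ λ { Fin.zero → e ; (Fin.suc i) → even i }

open LinearRelations ℤ.+-*-commutativeRing using (IsRelation; IsRelation-cancel; linearRelation)

ℤ-noZeroDivisors : ∀ x y → x ℤ.* y ≡ 0ℤ → (x ≡ 0ℤ) ⊎ (y ≡ 0ℤ)
ℤ-noZeroDivisors x y = ℤ.i*j≡0⇒i≡0∨j≡0 x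

-- Elimination over ℤ gives a nontrivial relation. While all its coefficients are even it can be
-- halved, and this must stop because the absolute value of one fixed nonzero coefficient drops each
-- time.
oddRelation : ∀ n (v : Fin (suc n) → Vector ℤ n) →
  Σ[ c ∈ Vector ℤ (suc n) ] (∃ λ i → Odd (c i)) × IsRelation c v
oddRelation n v with linearRelation ℤ-noZeroDivisors (λ ()) (ℤ._≟ 0ℤ) n v
... | c , (i , cᵢ≢0) , rel = descend c cᵢ≢0 rel (<-wellFounded _)
  where
  descend : (c : Vector ℤ (suc n)) → c i ≢ 0ℤ → IsRelation c v → Acc _<_ ∣ c i ∣ →
    Σ[ c ∈ Vector ℤ (suc n) ] (∃ λ i → Odd (c i)) × IsRelation c v
  descend c cᵢ≢0 rel (acc rec) with someOdd c
  ... | inj₁ odd  = c , odd , rel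
  ... | inj₂ even = descend half halfᵢ≢0
      (IsRelation-cancel ℤ-noZeroDivisors {c = c} {v = v} {x = + 2} (λ ()) (λ i → proj₂ (even i)) rel)
      (rec smaller)
    where
    half : Vector ℤ (suc n)
    half i = proj₁ (even i)

    halfᵢ≢0 : half i ≢ 0ℤ
    halfᵢ≢0 eq = cᵢ≢0 (≡.trans (proj₂ (even i)) (≡.cong (+ 2 ℤ.*_) eq))

    smaller : ∣ half i ∣ < ∣ c i ∣
    smaller = ≡.subst (∣ half i ∣ <_)
      (≡.trans (ℕ.*-comm ∣ half i ∣ 2)
        (≡.sym (≡.trans (≡.cong ∣_∣ (proj₂ (even i))) (ℤ.abs-* (+ 2) (half i)))))
      (ℕ.m<m*n ∣ half i ∣ 2 {{ℕ.≢-nonZero (halfᵢ≢0 ∘ ℤ.∣i∣≡0⇒i≡0)}} (s≤s (s≤s z≤n)))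

-- Roots of two

-- The form `s + suc u` splits `r ^ N` as `r ^ s * (r * r ^ u)`, exposing one factor `r` beyond
-- `r ^ s`.
∃-shift : ∀ {s N} → s < N → ∃ λ u → s ℕ.+ suc u ≡ N
∃-shift {s} {N} s<N = N ℕ.∸ suc s , ≡.trans (ℕ.+-suc s _) (ℕ.m+[n∸m]≡n s<N)

module IntegerScalars (R : CommutativeRing a ℓ) {⟦_⟧ : ℤ → CommutativeRing.Carrier R}
  (isHom : RingMorphisms.IsRingHomomorphism ℤ.+-*-rawRing (CommutativeRing.rawRing R) ⟦_⟧) where
  open CommutativeRing R hiding (zero)
  open RingMorphisms.IsRingHomomorphism isHom
  open RingProperties ring
  open SemiringSum semiring
  open SemiringExp semiring
  open SetoidReasoning setoid

  private
    morphism : ℤ.+-*-rawRing -Raw-AlmostCommutative⟶ fromCommutativeRing R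
    morphism = record { ⟦_⟧ = ⟦_⟧ ; +-homo = +-homo ; *-homo = *-homo ; -‿homo = -‿homo
                      ; 0-homo = 0#-homo ; 1-homo = 1#-homo }

    -- The ring solver compares its coefficients in ℤ, since equality in `R` need not be decidable.
    coefficient≟ : ∀ x y → Maybe (⟦ x ⟧ ≈ ⟦ y ⟧)
    coefficient≟ x y with x ℤ.≟ y
    ... | yes ≡.refl = just refl
    ... | no _       = nothing

  module Solver = RingSolver ℤ.+-*-rawRing (fromCommutativeRing R) morphism coefficient≟
  open Solver using (solve; _:+_; _:*_; _:-_; :-_; _:=_)

  homo-sum : ∀ {n} (z : Vector ℤ n) → ⟦ SemiringSum.sum ℤ.+-*-semiring z ⟧ ≈ sum (⟦_⟧ ∘ z)
  homo-sum {zero}  z = 0#-homo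
  homo-sum {suc n} z = trans (+-homo _ _) (+-congˡ (homo-sum (z ∘ Fin.suc)))

  ⟦suc⟧-* : ∀ n x → ⟦ + suc n ⟧ * x ≈ x + ⟦ + n ⟧ * x
  ⟦suc⟧-* n x = trans (*-congʳ (+-homo 1ℤ (+ n)))
    (trans (distribʳ x _ _) (+-congʳ (trans (*-congʳ 1#-homo) (*-identityˡ x))))

  -- The additive subgroup generated by `g`. Given inductively, it lets closure properties be proved
  -- by recursion on membership, without handling coefficient vectors.
  data Span {I : Set} (g : I → Carrier) : Pred Carrier (a ⊔ ℓ) where
    generator  : ∀ i → Span g (g i)
    0#-closed  : Span g 0#
    +-closed   : ∀ {x y} → Span g x → Span g y → Span g (x + y)
    neg-closed : ∀ {x} → Span g x → Span g (- x)
    respects-≈ : ∀ {x y} → x ≈ y → Span g x → Span g y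

  module _ {I : Set} {g : I → Carrier} where

    Span-⟦+⟧* : ∀ n {x} → Span g x → Span g (⟦ + n ⟧ * x)
    Span-⟦+⟧* zero    x∈ = respects-≈ (sym (trans (*-congʳ 0#-homo) (zeroˡ _))) 0#-closed
    Span-⟦+⟧* (suc n) x∈ = respects-≈ (sym (⟦suc⟧-* n _)) (+-closed x∈ (Span-⟦+⟧* n x∈))

    Span-⟦⟧* : ∀ z {x} → Span g x → Span g (⟦ z ⟧ * x)
    Span-⟦⟧* (+ n)    x∈ = Span-⟦+⟧* n x∈
    Span-⟦⟧* -[1+ n ] x∈ = respects-≈ (trans (-‿distribˡ-* _ _) (*-congʳ (sym (-‿homo (+ suc n)))))
                               (neg-closed (Span-⟦+⟧* (suc n) x∈))

    -- Multiplication by `u` is additive, so only the generators have to be checked.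
    Span-*-stable : ∀ {u} → (∀ i → Span g (u * g i)) → ∀ {x} → Span g x → Span g (u * x)
    Span-*-stable ug∈ (generator i)       = ug∈ i
    Span-*-stable ug∈ 0#-closed           = respects-≈ (sym (zeroʳ _)) 0#-closed
    Span-*-stable ug∈ (+-closed x∈ y∈)    =
      respects-≈ (sym (distribˡ _ _ _)) (+-closed (Span-*-stable ug∈ x∈) (Span-*-stable ug∈ y∈))
    Span-*-stable ug∈ (neg-closed x∈)     = respects-≈ (-‿distribʳ-* _ _) (neg-closed (Span-*-stable ug∈ x∈))
    Span-*-stable ug∈ (respects-≈ x≈y x∈) = respects-≈ (*-congˡ x≈y) (Span-*-stable ug∈ x∈)

    Span-^*-stable : ∀ {u} → (∀ {x} → Span g x → Span g (u * x)) →
      ∀ e {x} → Span g x → Span g (u ^ e * x)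
    Span-^*-stable u* zero    x∈ = respects-≈ (sym (*-identityˡ _)) x∈
    Span-^*-stable u* (suc e) x∈ = respects-≈ (sym (*-assoc _ _ _)) (u* (Span-^*-stable u* e x∈))

  module RootOfTwo {r ρ : Carrier} {N : ℕ} (0<N : 0 < N)
    (rᴺ≈2 : r ^ N ≈ ⟦ + 2 ⟧) (rρ≈1 : r * ρ ≈ 1#) where

    -- The powers below `N` suffice as additive generators of the ring, because `r ^ N` is the
    -- integer 2.
    ℤ[r] : Pred Carrier (a ⊔ ℓ)
    ℤ[r] = Span {I = Fin N} λ i → r ^ toℕ i

    r^∈ : ∀ {i} → i < N → ℤ[r] (r ^ i)
    r^∈ i<N = respects-≈ (^-congʳ r (Fin.toℕ-fromℕ< i<N)) (generator (fromℕ< i<N))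

    1∈ : ℤ[r] 1#
    1∈ = r^∈ 0<N

    r*-stable : ∀ {x} → ℤ[r] x → ℤ[r] (r * x)
    r*-stable = Span-*-stable λ i → r^[1+i]∈ (Fin.toℕ<n i)
      where
      r^[1+i]∈ : ∀ {i} → i < N → ℤ[r] (r ^ suc i)
      r^[1+i]∈ {i} i<N with ℕ.m≤n⇒m<n∨m≡n i<N
      ... | inj₁ 1+i<N   = r^∈ 1+i<N
      -- The top power wraps around: `r * r ^ (N - 1)` is twice the generator 1.
      ... | inj₂ ≡.refl  = respects-≈ (trans (*-identityʳ _) (sym rᴺ≈2)) (Span-⟦⟧* (+ 2) 1∈)

    eval : ∀ {m} → Vector ℤ m → Carrier
    eval c = sum λ i → ⟦ c i ⟧ * r ^ toℕ i

    eval-suc : ∀ {m} (c : Vector ℤ (suc m)) →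
      eval c ≈ ⟦ c Fin.zero ⟧ + r * eval (c ∘ Fin.suc)
    eval-suc c = +-cong (*-identityʳ _) (trans
      (sum-cong-≋ λ i → solve 3 (λ c r p → c :* (r :* p) := r :* (c :* p)) refl
                              ⟦ c (Fin.suc i) ⟧ r (r ^ toℕ i))
      (sym (*-distribˡ-sum r (λ i → ⟦ c (Fin.suc i) ⟧ * r ^ toℕ i))))

    eval∈ : ∀ {m} (c : Vector ℤ m) → ℤ[r] (eval c)
    eval∈ {zero}  c = 0#-closed
    eval∈ {suc m} c = respects-≈ (sym (eval-suc c))
      (+-closed (respects-≈ (*-identityʳ _) (Span-⟦⟧* (c Fin.zero) 1∈)) (r*-stable (eval∈ (c ∘ Fin.suc))))

    -- Multiplying by `ρ` undoes `r`, so `R` need not be a domain.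
    r*-cancel : ∀ {x y} → r * x ≈ r * y → x ≈ y
    r*-cancel {x} {y} eq = begin
      x              ≈⟨ *-identityˡ x ⟨
      1# * x         ≈⟨ *-congʳ rρ≈1 ⟨
      r * ρ * x      ≈⟨ solve 3 (λ r ρ x → r :* ρ :* x := ρ :* (r :* x)) refl r ρ x ⟩
      ρ * (r * x)    ≈⟨ *-congˡ eq ⟩
      ρ * (r * y)    ≈⟨ solve 3 (λ r ρ y → r :* ρ :* y := ρ :* (r :* y)) refl r ρ y ⟨
      r * ρ * y      ≈⟨ *-congʳ rρ≈1 ⟩
      1# * y         ≈⟨ *-identityˡ y ⟩
      y              ∎

    r^*-cancel : ∀ s {x y} → r ^ s * x ≈ r ^ s * y → x ≈ y
    r^*-cancel zero    eq = trans (sym (*-identityˡ _)) (trans eq (*-identityˡ _))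
    r^*-cancel (suc s) eq =
      r^*-cancel s (r*-cancel (trans (sym (*-assoc _ _ _)) (trans eq (*-assoc _ _ _))))

    -- Modulo 2 = r ^ N, the lowest odd coefficient c of the polynomial can be
    -- read as a unit times a power r ^ s with s < N; cancelling that power
    -- exhibits 1 as a multiple of r.
    ρ∈ : ∀ {m} s (c : Vector ℤ m) → s ℕ.+ m ≤ N → (∃ λ i → Odd (c i)) →
      ∀ {y} → ℤ[r] y → r ^ s * eval c ≈ ⟦ + 2 ⟧ * y → ℤ[r] ρ
    ρ∈ {suc m} s c s+m≤N (i , odd) {y} y∈ eq = split i odd
      where
      e = eval (c ∘ Fin.suc)

      -- For either parity the even part `2q` of the lowest coefficient is moved to the right-hand
      -- side, where it replaces `y` by `y - r ^ s * q`, still an element of ℤ[r].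
      shifted : ∀ q → ℤ[r] (y - r ^ s * ⟦ q ⟧)
      shifted q = +-closed y∈ (neg-closed (Span-^*-stable r*-stable s
        (respects-≈ (*-identityʳ _) (Span-⟦⟧* q 1∈))))

      odd⇒ρ∈ : Odd (c Fin.zero) → ℤ[r] ρ
      odd⇒ρ∈ (q , c₀≡) = respects-≈ (sym ρ≈) (+-closed (Span-^*-stable r*-stable u (shifted q))
                                           (neg-closed (eval∈ (c ∘ Fin.suc))))
        where
        s<N : s < N
        s<N = ℕ.≤-trans (ℕ.m<m+n s (s≤s z≤n)) s+m≤N
        u = proj₁ (∃-shift s<N)
        y′ = y - r ^ s * ⟦ q ⟧

        c₀≈ : ⟦ c Fin.zero ⟧ ≈ 1# + ⟦ + 2 ⟧ * ⟦ q ⟧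
        c₀≈ = trans (⟦⟧-cong c₀≡) (trans (+-homo _ _) (+-cong 1#-homo (*-homo _ _)))

        -- Adding and subtracting `2 * (r ^ s * q)` completes 1 to the coefficient `1 + 2q`, so that
        -- the hypothesis applies; the resulting factor 2 is then rewritten as `r ^ N`.
        step₁ : r ^ s * (1# + r * e) ≈ r ^ s * (r * (r ^ u * y′))
        step₁ = begin
          r ^ s * (1# + r * e)
            ≈⟨ solve 5 (λ p o x q t →
                 p :* (o :+ x) := p :* (o :+ t :* q :+ x) :- t :* (p :* q))
               refl (r ^ s) 1# (r * e) ⟦ q ⟧ ⟦ + 2 ⟧ ⟩
          r ^ s * (1# + ⟦ + 2 ⟧ * ⟦ q ⟧ + r * e) - ⟦ + 2 ⟧ * (r ^ s * ⟦ q ⟧)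
            ≈⟨ +-congʳ (trans (*-congˡ (trans (+-congʳ (sym c₀≈)) (sym (eval-suc c)))) eq) ⟩
          ⟦ + 2 ⟧ * y - ⟦ + 2 ⟧ * (r ^ s * ⟦ q ⟧)
            ≈⟨ x[y-z]≈xy-xz _ _ _ ⟨
          ⟦ + 2 ⟧ * y′
            ≈⟨ *-congʳ rᴺ≈2 ⟨
          r ^ N * y′
            ≈⟨ *-congʳ (trans (^-congʳ r (≡.sym (proj₂ (∃-shift s<N)))) (^-homo-* r s (suc u))) ⟩
          r ^ s * (r * r ^ u) * y′
            ≈⟨ solve 4 (λ p r v y → p :* (r :* v) :* y := p :* (r :* (v :* y)))
               refl (r ^ s) r (r ^ u) y′ ⟩
          r ^ s * (r * (r ^ u * y′)) ∎

        -- Cancelling `r ^ s` leaves `1 + r * e = r * (r ^ u * y′)`, so 1 is `r` times the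
        -- right-hand side.
        ρ≈ : ρ ≈ r ^ u * y′ - e
        ρ≈ = r*-cancel (begin
          r * ρ                       ≈⟨ rρ≈1 ⟩
          1#                          ≈⟨ solve 2 (λ o x → o := o :+ x :- x) refl 1# (r * e) ⟩
          1# + r * e - r * e          ≈⟨ +-congʳ (r^*-cancel s step₁) ⟩
          r * (r ^ u * y′) - r * e    ≈⟨ x[y-z]≈xy-xz _ _ _ ⟨
          r * (r ^ u * y′ - e)        ∎)

      even⇒shift : ∀ q → c Fin.zero ≡ + 2 ℤ.* q →
        r ^ suc s * e ≈ ⟦ + 2 ⟧ * (y - r ^ s * ⟦ q ⟧)
      even⇒shift q c₀≡ = begin
        r * r ^ s * e
          ≈⟨ solve 5 (λ r p e t q →
               r :* p :* e := p :* (t :* q :+ r :* e) :- t :* (p :* q))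
             refl r (r ^ s) e ⟦ + 2 ⟧ ⟦ q ⟧ ⟩
        r ^ s * (⟦ + 2 ⟧ * ⟦ q ⟧ + r * e) - ⟦ + 2 ⟧ * (r ^ s * ⟦ q ⟧)
          ≈⟨ +-congʳ (trans (*-congˡ (trans
               (+-congʳ (sym (trans (⟦⟧-cong c₀≡) (*-homo _ _)))) (sym (eval-suc c)))) eq) ⟩
        ⟦ + 2 ⟧ * y - ⟦ + 2 ⟧ * (r ^ s * ⟦ q ⟧)
          ≈⟨ x[y-z]≈xy-xz _ _ _ ⟨
        ⟦ + 2 ⟧ * (y - r ^ s * ⟦ q ⟧) ∎

      split : ∀ i → Odd (c i) → ℤ[r] ρ
      split Fin.zero    odd = odd⇒ρ∈ odd
      split (Fin.suc i) odd with parity (c Fin.zero)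
      ... | inj₂ odd₀       = odd⇒ρ∈ odd₀
      -- After the even coefficient is removed, one factor `r` of the tail joins `r ^ s`. The
      -- exponent grows as the vector shrinks, so the bound by `N` persists.
      ... | inj₁ (q , c₀≡)  = ρ∈ (suc s) (c ∘ Fin.suc)
        (≡.subst (_≤ N) (ℕ.+-suc s m) s+m≤N) (i , odd) (shifted q) (even⇒shift q c₀≡)

    module _ (ρ∈ : ℤ[r] ρ) where

      -- `ρ` lowers a positive power of `r` by one, so the only generator needing the hypothesis is
      -- 1, which is sent to `ρ`.
      ρ*-stable : ∀ {x} → ℤ[r] x → ℤ[r] (ρ * x)
      ρ*-stable = Span-*-stable λ i → ρr^∈ (toℕ i) (Fin.toℕ<n i)
        where
        ρr^∈ : ∀ i → i < N → ℤ[r] (ρ * r ^ i)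
        ρr^∈ zero    _     = respects-≈ (sym (*-identityʳ ρ)) ρ∈
        ρr^∈ (suc i) 1+i<N = respects-≈ (r*-cancel (sym (begin
            r * (ρ * (r * r ^ i))   ≈⟨ *-assoc _ _ _ ⟨
            r * ρ * (r * r ^ i)     ≈⟨ *-congʳ rρ≈1 ⟩
            1# * (r * r ^ i)        ≈⟨ *-identityˡ _ ⟩
            r * r ^ i               ∎)))
          (r^∈ (ℕ.<-trans (ℕ.n<1+n i) 1+i<N))

      r^ρ^ : ∀ e x → r ^ e * (ρ ^ e * x) ≈ x
      r^ρ^ zero    x = trans (*-identityˡ _) (*-identityˡ _)
      r^ρ^ (suc e) x = begin
        r * r ^ e * (ρ * ρ ^ e * x)
          ≈⟨ solve 5 (λ r p ρ q x → r :* p :* (ρ :* q :* x) := r :* ρ :* (p :* (q :* x)))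
             refl r (r ^ e) ρ (ρ ^ e) x ⟩
        r * ρ * (r ^ e * (ρ ^ e * x))  ≈⟨ *-cong rρ≈1 (r^ρ^ e x) ⟩
        1# * x                         ≈⟨ *-identityˡ x ⟩
        x                              ∎

      -- Each halving is a multiplication by `ρ ^ N`, the inverse of `r ^ N = 2`, and this does not
      -- leave ℤ[r].
      2-divisible : ∀ e {x} → ℤ[r] x → ∃ λ y → ℤ[r] y × ⟦ + (2 ℕ.^ e) ⟧ * y ≈ x
      2-divisible zero    {x} x∈ = x , x∈ , trans (*-congʳ 1#-homo) (*-identityˡ x)
      2-divisible (suc e) {x} x∈ =
        let y , y∈ , 2ᵉy≈x = 2-divisible e x∈ in
        ρ ^ N * y , Span-^*-stable ρ*-stable N y∈ , (begin
          ⟦ + (2 ℕ.* 2 ℕ.^ e) ⟧ * (ρ ^ N * y)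
            ≈⟨ *-congʳ (trans
                 (⟦⟧-cong (≡.trans (ℤ.pos-* 2 (2 ℕ.^ e)) (ℤ.*-comm (+ 2) (+ (2 ℕ.^ e)))))
                 (*-homo _ _)) ⟩
          ⟦ + (2 ℕ.^ e) ⟧ * ⟦ + 2 ⟧ * (ρ ^ N * y)
            ≈⟨ *-assoc _ _ _ ⟩
          ⟦ + (2 ℕ.^ e) ⟧ * (⟦ + 2 ⟧ * (ρ ^ N * y))
            ≈⟨ *-congˡ (trans (*-congʳ (sym rᴺ≈2)) (r^ρ^ N y)) ⟩
          ⟦ + (2 ℕ.^ e) ⟧ * y
            ≈⟨ 2ᵉy≈x ⟩
          x ∎)

-- Denominators with respect to a basis

*-≢0 : ∀ {x y} → x ≢ 0ℤ → y ≢ 0ℤ → x ℤ.* y ≢ 0ℤ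
*-≢0 {x} {y} x≢0 y≢0 xy≡0 = [ x≢0 , y≢0 ]′ (ℤ-noZeroDivisors x y xy≡0)

n<2^n : ∀ n → n < 2 ℕ.^ n
n<2^n zero    = s≤s z≤n
n<2^n (suc n) = ℕ.≤-trans (ℕ.+-mono-≤ (s≤s z≤n) (n<2^n n))
  (ℕ.+-mono-≤ (ℕ.m^n>0 2 n) (ℕ.≤-reflexive (≡.sym (ℕ.+-identityʳ _))))

-- Taking `e` to be the absolute value of `w` is enough: a nonzero multiple of `2 ^ e` has absolute
-- value at least `2 ^ e`, which exceeds `e`.
2^-divisible⇒0 : ∀ {w} → (∀ e → ∃ λ z → w ≡ + (2 ℕ.^ e) ℤ.* z) → w ≡ 0ℤ
2^-divisible⇒0 {w} div with div ∣ w ∣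
... | z , w≡ with z ℤ.≟ 0ℤ
...   | yes ≡.refl = ≡.trans w≡ (ℤ.*-zeroʳ (+ (2 ℕ.^ ∣ w ∣)))
...   | no z≢0     = contradiction (n<2^n ∣ w ∣) (ℕ.≤⇒≯
  (≡.subst (2 ℕ.^ ∣ w ∣ ≤_) (≡.sym (≡.trans (≡.cong ∣_∣ w≡) (ℤ.abs-* (+ (2 ℕ.^ ∣ w ∣)) z)))
    (ℕ.m≤m*n (2 ℕ.^ ∣ w ∣) ∣ z ∣ {{ℕ.≢-nonZero (z≢0 ∘ ℤ.∣i∣≡0⇒i≡0)}})))

module Lattices (R : CommutativeRing a ℓ) {⟦_⟧ : ℤ → CommutativeRing.Carrier R}
  (isHom : RingMorphisms.IsRingHomomorphism ℤ.+-*-rawRing (CommutativeRing.rawRing R) ⟦_⟧)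
  {n} (b : Vector (CommutativeRing.Carrier R) n) where
  open CommutativeRing R hiding (zero)
  open RingMorphisms.IsRingHomomorphism isHom
  open RingProperties ring
  open SemiringSum semiring
  open SemiringExp semiring
  open SetoidReasoning setoid
  open IntegerScalars R isHom

  comb : Vector ℤ n → Carrier
  comb z = sum λ j → ⟦ z j ⟧ * b j

  comb-0 : ∀ {z} → (∀ j → z j ≡ 0ℤ) → comb z ≈ 0#
  comb-0 {z} z≡0 = LinearRelations.sum-zero R (λ j → ⟦ z j ⟧ * b j) λ j →
    trans (*-congʳ (trans (⟦⟧-cong (z≡0 j)) 0#-homo)) (zeroˡ (b j))

  comb-+ : ∀ y z → comb (λ j → y j ℤ.+ z j) ≈ comb y + comb z
  comb-+ y z = trans
    (sum-cong-≋ λ j → trans (*-congʳ (+-homo (y j) (z j))) (distribʳ (b j) _ _))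
    (∑-distrib-+ (λ j → ⟦ y j ⟧ * b j) (λ j → ⟦ z j ⟧ * b j))

  comb-* : ∀ x z → comb (λ j → x ℤ.* z j) ≈ ⟦ x ⟧ * comb z
  comb-* x z = trans
    (sum-cong-≋ λ j → trans (*-congʳ (*-homo x (z j))) (*-assoc _ _ (b j)))
    (sym (*-distribˡ-sum ⟦ x ⟧ (λ j → ⟦ z j ⟧ * b j)))

  -- `D * x` lies in the lattice spanned over ℤ by `b`. That `D` is nonzero is demanded separately.
  HasDenominator : ℤ → Pred Carrier ℓ
  HasDenominator D x = ∃ λ z → ⟦ D ⟧ * x ≈ comb z

  HasDenominator-*ˡ : ∀ E {D x} → HasDenominator D x → HasDenominator (E ℤ.* D) x
  HasDenominator-*ˡ E {D} (z , eq) = (λ j → E ℤ.* z j) ,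
    trans (*-congʳ (*-homo E D)) (trans (*-assoc _ _ _) (trans (*-congˡ eq) (sym (comb-* E z))))

  HasDenominator-*ʳ : ∀ E {D x} → HasDenominator D x → HasDenominator (D ℤ.* E) x
  HasDenominator-*ʳ E {D} {x} den =
    ≡.subst (λ D → HasDenominator D x) (ℤ.*-comm E D) (HasDenominator-*ˡ E den)

  commonDenominator : ∀ {m} (x : Vector Carrier m) →
    (∀ i → ∃ λ D → D ≢ 0ℤ × HasDenominator D (x i)) →
    ∃ λ D → D ≢ 0ℤ × ∀ i → HasDenominator D (x i)
  commonDenominator {zero}  x dens = 1ℤ , (λ ()) , λ ()
  commonDenominator {suc m} x dens =
    let E , E≢0 , den = dens Fin.zero
        D , D≢0 , dens′ = commonDenominator (x ∘ Fin.suc) (dens ∘ Fin.suc) in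
    E ℤ.* D , *-≢0 E≢0 D≢0 , λ
      { Fin.zero    → HasDenominator-*ʳ D den
      ; (Fin.suc i) → HasDenominator-*ˡ E (dens′ i)
      }

  -- For fixed `D` these elements form an additive group, so a denominator common to the generators
  -- serves the whole span.
  Span-hasDenominator : ∀ {I : Set} {g : I → Carrier} {D} → (∀ i → HasDenominator D (g i)) →
    ∀ {x} → Span g x → HasDenominator D x
  Span-hasDenominator den (generator i)       = den i
  Span-hasDenominator den 0#-closed           = (λ _ → 0ℤ) , trans (zeroʳ _) (sym (comb-0 λ _ → ≡.refl))
  Span-hasDenominator den (+-closed x∈ y∈)    =
    let y , eq₁ = Span-hasDenominator den x∈
        z , eq₂ = Span-hasDenominator den y∈ in
    (λ j → y j ℤ.+ z j) , trans (distribˡ _ _ _) (trans (+-cong eq₁ eq₂) (sym (comb-+ y z)))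
  Span-hasDenominator den (neg-closed x∈)     =
    let z , eq = Span-hasDenominator den x∈ in
    (λ j → ℤ.-1ℤ ℤ.* z j) , (begin
      _ * - _              ≈⟨ -‿distribʳ-* _ _ ⟨
      - (_ * _)            ≈⟨ -‿cong eq ⟩
      - comb z             ≈⟨ -1*x≈-x _ ⟨
      - 1# * comb z        ≈⟨ *-congʳ (trans (-‿homo 1ℤ) (-‿cong 1#-homo)) ⟨
      ⟦ ℤ.-1ℤ ⟧ * comb z   ≈⟨ comb-* ℤ.-1ℤ z ⟨
      comb (λ j → ℤ.-1ℤ ℤ.* z j) ∎)
  Span-hasDenominator den (respects-≈ x≈y x∈) =
    let z , eq = Span-hasDenominator den x∈ in z , trans (*-congˡ (sym x≈y)) eq

  -- Exchanging the two sums makes the coefficient of `b j` the `j`-th column sum of the relation,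
  -- which is zero.
  IsRelation⇒≈0 : ∀ {m D} {x : Vector Carrier m} {v : Fin m → Vector ℤ n} {c} →
    (∀ i → ⟦ D ⟧ * x i ≈ comb (v i)) → IsRelation c v →
    ⟦ D ⟧ * sum (λ i → ⟦ c i ⟧ * x i) ≈ 0#
  IsRelation⇒≈0 {D = D} {x} {v} {c} Dx≈ rel = begin
    ⟦ D ⟧ * sum (λ i → ⟦ c i ⟧ * x i)
      ≈⟨ *-distribˡ-sum ⟦ D ⟧ (λ i → ⟦ c i ⟧ * x i) ⟩
    sum (λ i → ⟦ D ⟧ * (⟦ c i ⟧ * x i))
      ≈⟨ sum-cong-≋ (λ i → trans
           (Solver.solve 3 (λ D c x → D :* (c :* x) := c :* (D :* x)) refl ⟦ D ⟧ ⟦ c i ⟧ (x i))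
           (trans (*-congˡ (Dx≈ i)) (sym (comb-* (c i) (v i))))) ⟩
    sum (λ i → sum (λ j → ⟦ c i ℤ.* v i j ⟧ * b j))
      ≈⟨ ∑-comm (λ i j → ⟦ c i ℤ.* v i j ⟧ * b j) ⟩
    sum (λ j → sum (λ i → ⟦ c i ℤ.* v i j ⟧ * b j))
      ≈⟨ sum-cong-≋ (λ j → trans
           (sym (*-distribʳ-sum (b j) (λ i → ⟦ c i ℤ.* v i j ⟧)))
           (*-congʳ (sym (homo-sum (λ i → c i ℤ.* v i j))))) ⟩
    comb (λ j → SemiringSum.sum ℤ.+-*-semiring (λ i → c i ℤ.* v i j))
      ≈⟨ comb-0 rel ⟩
    0# ∎
    where open Solver using (_:*_; _:=_)

  module _ (1≉0 : ¬ 1# ≈ 0#)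
           (torsionFree : ∀ {D x} → D ≢ 0ℤ → ⟦ D ⟧ * x ≈ 0# → x ≈ 0#)
           (independent : ∀ z → comb z ≈ 0# → ∀ j → z j ≡ 0ℤ)
           (denominator : ∀ x → ∃ λ D → D ≢ 0ℤ × HasDenominator D x) where

    noRootOfTwo : ∀ {N r ρ} → n < N → r ^ N ≈ ⟦ + 2 ⟧ → ¬ r * ρ ≈ 1#
    noRootOfTwo {N} {r} {ρ} n<N rᴺ≈2 rρ≈1 =
      1≉0 (torsionFree D≢0 (trans (proj₂ (den 1∈)) (comb-0 (2^-divisible⇒0 ∘ w-divisible))))
      where
      open RootOfTwo (ℕ.≤-<-trans z≤n n<N) rᴺ≈2 rρ≈1

      common : ∃ λ D → D ≢ 0ℤ × ∀ (i : Fin N) → HasDenominator D (r ^ toℕ i)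
      common = commonDenominator (λ i → r ^ toℕ i) (λ i → denominator (r ^ toℕ i))
      D = proj₁ common
      D≢0 = proj₁ (proj₂ common)

      den : ∀ {x} → ℤ[r] x → HasDenominator D x
      den = Span-hasDenominator (proj₂ (proj₂ common))

      -- Since `n < N`, the exponents 0, ..., n all occur among the generators. Their n + 1
      -- coordinate vectors in ℤⁿ must be related.
      den^ : ∀ (i : Fin (suc n)) → HasDenominator D (r ^ toℕ i)
      den^ i = den (r^∈ (ℕ.≤-<-trans (ℕ.≤-pred (Fin.toℕ<n i)) n<N))

      relation = oddRelation n (λ i → proj₁ (den^ i))
      c : Vector ℤ (suc n)
      c = proj₁ relation

      eval≈0 : eval c ≈ 0#
      eval≈0 = torsionFree D≢0
        (IsRelation⇒≈0 {x = λ i → r ^ toℕ i} {c = c} (λ i → proj₂ (den^ i)) (proj₂ (proj₂ relation)))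

      ρ∈ℤ[r] : ℤ[r] ρ
      -- The vanishing of `eval c` is read as `r ^ 0 * eval c = 2 * 0`.
      ρ∈ℤ[r] = ρ∈ 0 c n<N (proj₁ (proj₂ relation)) 0#-closed
        (trans (*-congˡ eval≈0) (trans (zeroʳ _) (sym (zeroʳ _))))

      w = proj₁ (den 1∈)

      -- Write 1 as `2 ^ e * y` with `y` in ℤ[r]. Then `w` and `2 ^ e` times `z` are both
      -- coordinates of `D * 1`, and independence of `b` identifies them.
      w-divisible : ∀ j e → ∃ λ z → w j ≡ + (2 ℕ.^ e) ℤ.* z
      w-divisible j e = z j , ℤ.i-j≡0⇒i≡j (w j) _ (≡.trans
        (≡.cong (λ x → w j ℤ.+ x) (ℤ.neg-distribˡ-* E (z j)))
        (independent (λ j → w j ℤ.+ ℤ.- E ℤ.* z j) comb≈0 j))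
        where
        E = + (2 ℕ.^ e)
        y = proj₁ (2-divisible ρ∈ℤ[r] e 1∈)
        y∈ = proj₁ (proj₂ (2-divisible ρ∈ℤ[r] e 1∈))
        Ey≈1 = proj₂ (proj₂ (2-divisible ρ∈ℤ[r] e 1∈))
        z = proj₁ (den y∈)

        comb≈0 : comb (λ j → w j ℤ.+ ℤ.- E ℤ.* z j) ≈ 0#
        comb≈0 = begin
          comb (λ j → w j ℤ.+ ℤ.- E ℤ.* z j)
            ≈⟨ comb-+ w (λ j → ℤ.- E ℤ.* z j) ⟩
          comb w + comb (λ j → ℤ.- E ℤ.* z j)
            ≈⟨ +-cong (sym (proj₂ (den 1∈)))
                 (trans (comb-* (ℤ.- E) z) (*-cong (-‿homo E) (sym (proj₂ (den y∈))))) ⟩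
          ⟦ D ⟧ * 1# + - ⟦ E ⟧ * (⟦ D ⟧ * y)
            ≈⟨ +-cong (*-congˡ (sym Ey≈1)) refl ⟩
          ⟦ D ⟧ * (⟦ E ⟧ * y) + - ⟦ E ⟧ * (⟦ D ⟧ * y)
            ≈⟨ Solver.solve 3 (λ D E y →
                 D :* (E :* y) :+ (:- E) :* (D :* y) := con 0ℤ) refl ⟦ D ⟧ ⟦ E ⟧ y ⟩
          ⟦ 0ℤ ⟧
            ≈⟨ 0#-homo ⟩
          0# ∎
          where open Solver using (_:*_; _:+_; :-_; _:=_; con)

-- Number fields have nonsquares

-- The quotient is normalised by a gcd that does not reduce on variables; the laws below are
-- therefore checked on unnormalised rationals.
fromℤ : ℤ → ℚ
fromℤ z = z ℚ./ 1

toℚᵘ-fromℤ : ∀ z → toℚᵘ (fromℤ z) ≃ᵘ mkℚᵘ z 0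
toℚᵘ-fromℤ z = ℚ.toℚᵘ-fromℚᵘ (mkℚᵘ z 0)

fromℤ-injective : ∀ {x y} → fromℤ x ≡ fromℤ y → x ≡ y
fromℤ-injective {x} {y} eq with ℚ.fromℚᵘ-injective {mkℚᵘ x 0} {mkℚᵘ y 0} eq
... | *≡* x*1≡y*1 = ℤ.*-cancelʳ-≡ x y (+ 1) x*1≡y*1

fromℤ-+ : ∀ x y → fromℤ (x ℤ.+ y) ≡ fromℤ x ℚ.+ fromℤ y
fromℤ-+ x y = ℚ.toℚᵘ-injective (begin
  toℚᵘ (fromℤ (x ℤ.+ y))                  ≈⟨ toℚᵘ-fromℤ (x ℤ.+ y) ⟩
  mkℚᵘ (x ℤ.+ y) 0                        ≈⟨ *≡* (lemma x y) ⟩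
  mkℚᵘ x 0 ℚᵘ.+ mkℚᵘ y 0                  ≈⟨ ℚᵘ.+-cong (toℚᵘ-fromℤ x) (toℚᵘ-fromℤ y) ⟨
  toℚᵘ (fromℤ x) ℚᵘ.+ toℚᵘ (fromℤ y)      ≈⟨ ℚ.toℚᵘ-homo-+ (fromℤ x) (fromℤ y) ⟨
  toℚᵘ (fromℤ x ℚ.+ fromℤ y)              ∎)
  where
  open SetoidReasoning ℚᵘ.≃-setoid
  lemma : ∀ x y → (x ℤ.+ y) ℤ.* + 1 ≡ (x ℤ.* + 1 ℤ.+ y ℤ.* + 1) ℤ.* + 1
  lemma = ℤ-RingSolver.solve-∀

fromℤ-* : ∀ x y → fromℤ (x ℤ.* y) ≡ fromℤ x ℚ.* fromℤ y
fromℤ-* x y = ℚ.toℚᵘ-injective (begin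
  toℚᵘ (fromℤ (x ℤ.* y))                  ≈⟨ toℚᵘ-fromℤ (x ℤ.* y) ⟩
  mkℚᵘ (x ℤ.* y) 0                        ≈⟨ ℚᵘ.*-cong (toℚᵘ-fromℤ x) (toℚᵘ-fromℤ y) ⟨
  toℚᵘ (fromℤ x) ℚᵘ.* toℚᵘ (fromℤ y)      ≈⟨ ℚ.toℚᵘ-homo-* (fromℤ x) (fromℤ y) ⟨
  toℚᵘ (fromℤ x ℚ.* fromℤ y)              ∎)
  where open SetoidReasoning ℚᵘ.≃-setoid

fromℤ-neg : ∀ x → fromℤ (ℤ.- x) ≡ ℚ.- fromℤ x
fromℤ-neg x = ℚ.toℚᵘ-injective (begin
  toℚᵘ (fromℤ (ℤ.- x))   ≈⟨ toℚᵘ-fromℤ (ℤ.- x) ⟩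
  mkℚᵘ (ℤ.- x) 0         ≈⟨ ℚᵘ.-‿cong (toℚᵘ-fromℤ x) ⟨
  ℚᵘ.- toℚᵘ (fromℤ x)    ≈⟨ ℚ.toℚᵘ-homo‿- (fromℤ x) ⟨
  toℚᵘ (ℚ.- fromℤ x)     ∎)
  where open SetoidReasoning ℚᵘ.≃-setoid

fromℤ-isRingHomomorphism :
  RingMorphisms.IsRingHomomorphism ℤ.+-*-rawRing (FieldOps.rawRing ℚ-field) fromℤ
fromℤ-isRingHomomorphism = record
  { isSemiringHomomorphism = record
    { isNearSemiringHomomorphism = record
      { +-isMonoidHomomorphism = record
        { isMagmaHomomorphism = record
          { isRelHomomorphism = record { cong = ≡.cong fromℤ }
          ; homo = fromℤ-+
          }
        ; ε-homo = ≡.refl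
        }
      ; *-homo = fromℤ-*
      }
    ; 1#-homo = ≡.refl
    }
  ; -‿homo = fromℤ-neg
  }

↧*≡↥ : ∀ q → fromℤ (↧ q) ℚ.* q ≡ fromℤ (↥ q)
↧*≡↥ q@record{} = ℚ.toℚᵘ-injective (begin
  toℚᵘ (fromℤ (↧ q) ℚ.* q)          ≈⟨ ℚ.toℚᵘ-homo-* (fromℤ (↧ q)) q ⟩
  toℚᵘ (fromℤ (↧ q)) ℚᵘ.* toℚᵘ q    ≈⟨ ℚᵘ.*-congʳ (toℚᵘ-fromℤ (↧ q)) ⟩
  mkℚᵘ (↧ q) 0 ℚᵘ.* toℚᵘ q          ≈⟨ *≡* (lemma (↧ q) (↥ q)) ⟩
  mkℚᵘ (↥ q) 0                      ≈⟨ toℚᵘ-fromℤ (↥ q) ⟨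
  toℚᵘ (fromℤ (↥ q))                ∎)
  where
  open SetoidReasoning ℚᵘ.≃-setoid
  lemma : ∀ d n → d ℤ.* n ℤ.* + 1 ≡ n ℤ.* (+ 1 ℤ.* d)
  lemma = ℤ-RingSolver.solve-∀

clearDenominators : ∀ {n} (s : Vector ℚ n) →
  ∃ λ D → D ≢ 0ℤ × ∀ j → ∃ λ z → fromℤ D ℚ.* s j ≡ fromℤ z
clearDenominators {zero}  s = 1ℤ , (λ ()) , λ ()
clearDenominators {suc n} s =
  let D , D≢0 , cleared = clearDenominators (s ∘ Fin.suc)
      q = s Fin.zero in
  ↧ q ℤ.* D , *-≢0 {↧ q} (λ ()) D≢0 , λ
    { Fin.zero    → D ℤ.* ↥ q , (begin
        fromℤ (↧ q ℤ.* D) ℚ.* q               ≡⟨ ≡.cong (λ x → fromℤ x ℚ.* q) (ℤ.*-comm (↧ q) D) ⟩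
        fromℤ (D ℤ.* ↧ q) ℚ.* q               ≡⟨ ≡.cong (ℚ._* q) (fromℤ-* D (↧ q)) ⟩
        fromℤ D ℚ.* fromℤ (↧ q) ℚ.* q         ≡⟨ ℚ.*-assoc (fromℤ D) _ q ⟩
        fromℤ D ℚ.* (fromℤ (↧ q) ℚ.* q)       ≡⟨ ≡.cong (fromℤ D ℚ.*_) (↧*≡↥ q) ⟩
        fromℤ D ℚ.* fromℤ (↥ q)               ≡⟨ fromℤ-* D (↥ q) ⟨
        fromℤ (D ℤ.* ↥ q)                     ∎)
    ; (Fin.suc j) → let z , eq = cleared j in ↧ q ℤ.* z , (begin
        fromℤ (↧ q ℤ.* D) ℚ.* s (Fin.suc j)             ≡⟨ ≡.cong (ℚ._* s (Fin.suc j)) (fromℤ-* (↧ q) D) ⟩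
        fromℤ (↧ q) ℚ.* fromℤ D ℚ.* s (Fin.suc j)       ≡⟨ ℚ.*-assoc (fromℤ (↧ q)) (fromℤ D) _ ⟩
        fromℤ (↧ q) ℚ.* (fromℤ D ℚ.* s (Fin.suc j))     ≡⟨ ≡.cong (fromℤ (↧ q) ℚ.*_) eq ⟩
        fromℤ (↧ q) ℚ.* fromℤ z                         ≡⟨ fromℤ-* (↧ q) z ⟨
        fromℤ (↧ q ℤ.* z)                               ∎)
    }
  where open ≡.≡-Reasoning

commutativeRing : HeytingField κ ℓ₁ ℓ₂ → CommutativeRing κ ℓ₁
commutativeRing k = HeytingCommutativeRing.commutativeRing (HeytingField.heytingCommutativeRing k)

IsSquare : (k : HeytingField κ ℓ₁ ℓ₂) → Pred (HeytingField.Carrier k) _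
IsSquare k w = ∃ λ s → s * s ≈ w
  where open HeytingField k

module CharacteristicZero (k : HeytingField κ ℓ₁ ℓ₂) (ℚ⊆k : Extension ℚ-field k) where
  open CommutativeRing (commutativeRing k) hiding (zero)
  open Extension ℚ⊆k using (ι) renaming (isRingHomomorphism to ι-isRingHomomorphism)
  private module ι = RingMorphisms.IsRingHomomorphism ι-isRingHomomorphism
  open SetoidReasoning setoid

  ⟦_⟧ : ℤ → Carrier
  ⟦ z ⟧ = ι (fromℤ z)

  ⟦⟧-isRingHomomorphism : RingMorphisms.IsRingHomomorphism ℤ.+-*-rawRing rawRing ⟦_⟧
  ⟦⟧-isRingHomomorphism = Composition.isRingHomomorphism trans
    fromℤ-isRingHomomorphism ι-isRingHomomorphism

  -- A nonzero rational is a unit, and its inverse maps into `k`. This is where characteristic zero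
  -- enters.
  ι-torsionFree : ∀ {q x} → q ≢ 0ℚ → ι q * x ≈ 0# → x ≈ 0#
  ι-torsionFree {q} {x} q≢0 qx≈0 = begin
    x                          ≈⟨ *-identityˡ x ⟨
    1# * x                     ≈⟨ *-congʳ (trans (sym ι.1#-homo) (ι.⟦⟧-cong (≡.sym (ℚ.*-inverseˡ q)))) ⟩
    ι (ℚ.1/ q ℚ.* q) * x       ≈⟨ *-congʳ (ι.*-homo (ℚ.1/ q) q) ⟩
    ι (ℚ.1/ q) * ι q * x       ≈⟨ *-assoc _ _ _ ⟩
    ι (ℚ.1/ q) * (ι q * x)     ≈⟨ *-congˡ qx≈0 ⟩
    ι (ℚ.1/ q) * 0#            ≈⟨ zeroʳ _ ⟩
    0#                         ∎
    where instance _ = ℚ.≢-nonZero q≢0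

  ⟦⟧-torsionFree : ∀ {D x} → D ≢ 0ℤ → ⟦ D ⟧ * x ≈ 0# → x ≈ 0#
  ⟦⟧-torsionFree D≢0 = ι-torsionFree (D≢0 ∘ fromℤ-injective)

module _ (k : HeytingField κ ℓ₁ ℓ₂) where
  open HeytingField k using (#-irrefl; heytingCommutativeRing)
  open CommutativeRing (commutativeRing k) hiding (zero)
  open SemiringExp semiring
  open SetoidReasoning setoid

  1≉0 : ¬ 1# ≈ 0#
  1≉0 1≈0 = #-irrefl 1≈0 (HeytingProperties.1#0 heytingCommutativeRing)

  -- Square roots are iterated: a square root of a `2 ^ m`-th root is a `2 ^ (m + 1)`-th root.
  2^-root : (∀ w → IsSquare k w) → ∀ m x → ∃ λ r → r ^ (2 ℕ.^ m) ≈ x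
  2^-root √ zero    x = x , *-identityʳ x
  2^-root √ (suc m) x =
    let r , rᴺ≈x = 2^-root √ m x
        s , s²≈r = √ r in
    s , (begin
      s ^ (2 ℕ.* 2 ℕ.^ m)      ≈⟨ ^-assocʳ s 2 (2 ℕ.^ m) ⟨
      (s ^ 2) ^ (2 ℕ.^ m)      ≈⟨ ^-congˡ (2 ℕ.^ m) (trans (*-congˡ (*-identityʳ s)) s²≈r) ⟩
      r ^ (2 ℕ.^ m)            ≈⟨ rᴺ≈x ⟩
      x                        ∎)

  ¬allSquares : IsNumberField k → ¬ (∀ w → IsSquare k w)
  ¬allSquares nf √ = noRootOfTwo 1≉0 ⟦⟧-torsionFree independentℤ denominator
    (n<2^n n) rᴺ≈2 (proj₂ (root-inverse (ℕ.m^n>0 2 n) rᴺ≈2))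
    where
    open IsNumberField nf
    open CharacteristicZero k ℚ⊆k
    open Extension ℚ⊆k using (ι) renaming (isRingHomomorphism to ι-isRingHomomorphism)
    module ι = RingMorphisms.IsRingHomomorphism ι-isRingHomomorphism
    n = proj₁ finiteDegree
    b = proj₁ (proj₂ finiteDegree)
    open IsBasis (proj₂ (proj₂ finiteDegree))
    open Lattices (commutativeRing k) ⟦⟧-isRingHomomorphism b
    open SemiringSum semiring

    r = proj₁ (2^-root √ n ⟦ + 2 ⟧)
    rᴺ≈2 = proj₂ (2^-root √ n ⟦ + 2 ⟧)

    -- The inverse of `r` is `r ^ (N - 1) / 2`. Keeping `N` a variable allows it to be matched as a
    -- successor, which `2 ^ n` does not permit.
    root-inverse : ∀ {N} → 0 < N → r ^ N ≈ ⟦ + 2 ⟧ → ∃ λ ρ → r * ρ ≈ 1#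
    root-inverse {suc N} _ rᴺ≈2 = r ^ N * ι ½ , (begin
      r * (r ^ N * ι ½)      ≈⟨ *-assoc _ _ _ ⟨
      r * r ^ N * ι ½        ≈⟨ *-congʳ rᴺ≈2 ⟩
      ι (fromℤ (+ 2)) * ι ½  ≈⟨ ι.*-homo (fromℤ (+ 2)) ½ ⟨
      ι 1ℚ                   ≈⟨ ι.1#-homo ⟩
      1#                     ∎)

    independentℤ : ∀ z → comb z ≈ 0# → ∀ j → z j ≡ 0ℤ
    independentℤ z eq j = fromℤ-injective (independent (fromℤ ∘ z) eq j)

    denominator : ∀ x → ∃ λ D → D ≢ 0ℤ × HasDenominator D x
    denominator x =
      let s , x≈ = spanning {x} _
          D , D≢0 , cleared = clearDenominators s in
      D , D≢0 , (λ j → proj₁ (cleared j)) , (begin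
        ⟦ D ⟧ * x
          ≈⟨ *-congˡ x≈ ⟩
        ⟦ D ⟧ * sum (λ j → ι (s j) * b j)
          ≈⟨ *-distribˡ-sum ⟦ D ⟧ (λ j → ι (s j) * b j) ⟩
        sum (λ j → ⟦ D ⟧ * (ι (s j) * b j))
          ≈⟨ sum-cong-≋ (λ j → trans (sym (*-assoc _ _ (b j)))
               (*-congʳ (trans (sym (ι.*-homo (fromℤ D) (s j))) (ι.⟦⟧-cong (proj₂ (cleared j)))))) ⟩
        comb (λ j → proj₁ (cleared j)) ∎)

lowerExcludedMiddle : ∀ b → ExcludedMiddle (a ⊔ b) → ExcludedMiddle a
lowerExcludedMiddle b em {P} = Dec.map′ lower lift (em {Lift b P})

-- Excluded middle is used twice: to extract a witness, and to turn the absence of nonsquares into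
-- actual square roots.
nonSquare : (k : HeytingField κ ℓ₁ ℓ₂) → ExcludedMiddle (κ ⊔ ℓ₁) → IsNumberField k →
  ∃ λ w → ¬ IsSquare k w
nonSquare k em nf = decidable-stable em λ none →
  ¬allSquares k nf λ w → decidable-stable em λ ¬square → none (w , ¬square)

-- Quadratic extensions and quadratic points

module Apartness (k : HeytingField κ ℓ₁ ℓ₂) where
  open HeytingField k using (_#_; tight; #⇒invertible; heytingCommutativeRing)
  open CommutativeRing (commutativeRing k) hiding (zero)
  open HeytingProperties heytingCommutativeRing using (x-0≈x)

  ≉⇒# : ExcludedMiddle ℓ₂ → ∀ {x y} → ¬ x ≈ y → x # y
  ≉⇒# em {x} {y} x≉y = decidable-stable em λ ¬x#y → x≉y (proj₁ (tight x y) ¬x#y)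

  inverse : ExcludedMiddle ℓ₂ → ∀ {x} → ¬ x ≈ 0# → ∃ λ y → x * y ≈ 1#
  inverse em {x} x≉0 =
    let y , _ , xy≈1 = #⇒invertible (≉⇒# em x≉0) in y , trans (*-congʳ (sym (x-0≈x x))) xy≈1

module _ {k K : HeytingField κ ℓ₁ ℓ₂} (k⊆K : Extension k K) where
  private
    module k where
      open CommutativeRing (commutativeRing k) public
      open RingProperties ring public
    module K where
      open CommutativeRing (commutativeRing K) public
      open RingProperties ring public
  open Extension k⊆K
  private module ι = RingMorphisms.IsRingHomomorphism isRingHomomorphism
  open SetoidReasoning K.setoid

  -- If `x # y`, the unit `x - y` would be sent to zero and 1 would vanish in `K`. Tightness of the
  -- apartness then gives equality.
  ι-injective : ∀ {x y} → ι x K.≈ ι y → x k.≈ y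
  ι-injective {x} {y} ιx≈ιy = proj₁ (HeytingField.tight k x y) λ x#y →
    let u , u[x-y]≈1 , _ = HeytingField.#⇒invertible k x#y in
    1≉0 K (begin
      K.1#                        ≈⟨ ι.1#-homo ⟨
      ι k.1#                      ≈⟨ ι.⟦⟧-cong u[x-y]≈1 ⟨
      ι (u k.* (x k.- y))         ≈⟨ ι.*-homo u _ ⟩
      ι u K.* ι (x k.- y)         ≈⟨ K.*-congˡ (K.trans (ι.+-homo x _) (K.+-congˡ (ι.-‿homo y))) ⟩
      ι u K.* (ι x K.- ι y)       ≈⟨ K.*-congˡ (K.+-congʳ ιx≈ιy) ⟩
      ι u K.* (ι y K.- ι y)       ≈⟨ K.*-congˡ (K.-‿inverseʳ (ι y)) ⟩
      ι u K.* K.0#                ≈⟨ K.zeroʳ _ ⟩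
      K.0#                        ∎)

  ι≈0⇒≈0 : ∀ {x} → ι x K.≈ K.0# → x k.≈ k.0#
  ι≈0⇒≈0 ιx≈0 = ι-injective (K.trans ιx≈0 (K.sym ι.0#-homo))

  Image : Pred K.Carrier _
  Image u = ∃ λ v → u K.≈ ι v

  Image-0# : Image K.0#
  Image-0# = k.0# , K.sym ι.0#-homo

  Image-1# : Image K.1#
  Image-1# = k.1# , K.sym ι.1#-homo

  Image-ι : ∀ x → Image (ι x)
  Image-ι x = x , K.refl

  Image-+ : ∀ {u v} → Image u → Image v → Image (u K.+ v)
  Image-+ (x , u≈) (y , v≈) = x k.+ y , K.trans (K.+-cong u≈ v≈) (K.sym (ι.+-homo x y))

  Image-* : ∀ {u v} → Image u → Image v → Image (u K.* v)
  Image-* (x , u≈) (y , v≈) = x k.* y , K.trans (K.*-cong u≈ v≈) (K.sym (ι.*-homo x y))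

  Image-^ : ∀ {u} → Image u → ∀ n → Image (FieldOps._^_ K u n)
  Image-^ u∈ zero    = Image-1#
  Image-^ u∈ (suc n) = Image-* u∈ (Image-^ u∈ n)

  Image-sum : ∀ {n} {u : Vector K.Carrier n} → (∀ i → Image (u i)) → Image (FieldOps.sum K u)
  Image-sum {zero}  u∈ = Image-0#
  Image-sum {suc n} u∈ = Image-+ (u∈ 0F) (Image-sum (u∈ ∘ Fin.suc))

  -- `value` is computed in `K`; the preimage found here is the element of `k` whose being a square
  -- or not decides the choice of quadratic field.
  Image-value : ∀ f {x y} → Image x → Image y → Image (Curve.value k⊆K f x y)
  Image-value f x∈ y∈ = Image-sum λ i → Image-sum λ j →
    Image-* (Image-ι (Polynomial₂.coeff f i j)) (Image-* (Image-^ x∈ (toℕ i)) (Image-^ y∈ (toℕ j)))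

  module QuadraticExtension (ℚ⊆k : Extension ℚ-field k) (em₁ : ExcludedMiddle ℓ₁)
    (em₂ : ExcludedMiddle ℓ₂) {w z} (¬square : ¬ IsSquare k w) (z²≈w : z K.* z K.≈ ι w) where

    open IntegerScalars (commutativeRing K)
      (Composition.isRingHomomorphism K.trans
        (CharacteristicZero.⟦⟧-isRingHomomorphism k ℚ⊆k) isRingHomomorphism)
      using (module Solver)
    open Solver using (solve; _:+_; _:*_; _:-_; :-_; _:=_)

    -- The field k(z): as `z * z` lies in `k`, no higher powers of `z` are required.
    k⟨z⟩ : Pred K.Carrier (κ ⊔ ℓ₁)
    k⟨z⟩ u = ∃₂ λ p q → u K.≈ ι p K.+ ι q K.* z

    -- If `q` were nonzero, `- p / q` would be an element of `k` mapping to `z`, hence a square root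
    -- of `w` in `k`. So `q` vanishes, and then so does `p`.
    independent : ∀ {p q} → ι p K.+ ι q K.* z K.≈ K.0# → p k.≈ k.0# × q k.≈ k.0#
    independent {p} {q} p+qz≈0 = ι≈0⇒≈0 ιp≈0 , q≈0
      where
      q≈0 : q k.≈ k.0#
      q≈0 = decidable-stable em₁ λ q≉0 →
        let q⁻¹ , qq⁻¹≈1 = Apartness.inverse k em₂ q≉0
            s = k.- (q⁻¹ k.* p)
            s≈z = begin
              ι s
                ≈⟨ K.trans (ι.-‿homo _) (K.-‿cong (ι.*-homo q⁻¹ p)) ⟩
              K.- (ι q⁻¹ K.* ι p)
                ≈⟨ solve 4 (λ i p q z → :- (i :* p) := q :* i :* z :- i :* (p :+ q :* z))
                   K.refl (ι q⁻¹) (ι p) (ι q) z ⟩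
              ι q K.* ι q⁻¹ K.* z K.- ι q⁻¹ K.* (ι p K.+ ι q K.* z)
                ≈⟨ K.+-cong
                     (K.*-congʳ (K.trans (K.sym (ι.*-homo q q⁻¹)) (K.trans (ι.⟦⟧-cong qq⁻¹≈1) ι.1#-homo)))
                     (K.-‿cong (K.trans (K.*-congˡ p+qz≈0) (K.zeroʳ _))) ⟩
              K.1# K.* z K.- K.0#
                ≈⟨ K.+-cong (K.*-identityˡ z) K.-0#≈0# ⟩
              z K.+ K.0#
                ≈⟨ K.+-identityʳ z ⟩
              z ∎
        in ¬square (s , ι-injective
             (K.trans (ι.*-homo s s) (K.trans (K.*-cong s≈z s≈z) z²≈w)))

      ιp≈0 : ι p K.≈ K.0#
      ιp≈0 = begin
        ι p                      ≈⟨ K.+-identityʳ _ ⟨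
        ι p K.+ K.0#             ≈⟨ K.+-congˡ (K.trans (K.*-congʳ (K.trans (ι.⟦⟧-cong q≈0) ι.0#-homo)) (K.zeroˡ z)) ⟨
        ι p K.+ ι q K.* z        ≈⟨ p+qz≈0 ⟩
        K.0#                     ∎

    ι∈k⟨z⟩ : ∀ s → k⟨z⟩ (ι s)
    ι∈k⟨z⟩ s = s , k.0# , K.sym (K.trans
      (K.+-congˡ (K.trans (K.*-congʳ ι.0#-homo) (K.zeroˡ z))) (K.+-identityʳ _))

    z∈k⟨z⟩ : k⟨z⟩ z
    z∈k⟨z⟩ = k.0# , k.1# , K.sym (K.trans
      (K.+-cong ι.0#-homo (K.trans (K.*-congʳ ι.1#-homo) (K.*-identityˡ z))) (K.+-identityˡ _))

    private
      -- The norm of `p + q z` as its product with the conjugate `p - q z`.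
      ι-norm : ∀ p q → ι (p k.* p k.- q k.* q k.* w) K.≈
                       (ι p K.+ ι q K.* z) K.* (ι p K.- ι q K.* z)
      ι-norm p q = begin
        ι (p k.* p k.- q k.* q k.* w)
          ≈⟨ K.trans (ι.+-homo _ _) (K.+-cong (ι.*-homo p p)
               (K.trans (ι.-‿homo _) (K.-‿cong (K.trans (ι.*-homo _ w)
                 (K.*-cong (ι.*-homo q q) (K.sym z²≈w)))))) ⟩
        ι p K.* ι p K.- ι q K.* ι q K.* (z K.* z)
          ≈⟨ solve 3 (λ p q z → p :* p :- q :* q :* (z :* z) := (p :+ q :* z) :* (p :- q :* z))
             K.refl (ι p) (ι q) z ⟩
        (ι p K.+ ι q K.* z) K.* (ι p K.- ι q K.* z) ∎

    -- The inverse is the conjugate divided by the norm `n`: multiplying `u * v = 1` by the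
    -- conjugate gives `n * v`.
    inverse∈k⟨z⟩ : ∀ {u v} → k⟨z⟩ u → u K.* v K.≈ K.1# → k⟨z⟩ v
    inverse∈k⟨z⟩ {u} {v} (p , q , u≈) uv≈1 = n⁻¹ k.* p , k.- (n⁻¹ k.* q) , (begin
      v                                  ≈⟨ K.*-identityˡ v ⟨
      K.1# K.* v                         ≈⟨ K.*-congʳ (K.trans (K.sym ι.1#-homo)
                                              (K.trans (ι.⟦⟧-cong (k.sym nn⁻¹≈1)) (ι.*-homo n n⁻¹))) ⟩
      ι n K.* ι n⁻¹ K.* v                ≈⟨ solve 3 (λ n i v → n :* i :* v := i :* (n :* v))
                                              K.refl (ι n) (ι n⁻¹) v ⟩
      ι n⁻¹ K.* (ι n K.* v)              ≈⟨ K.*-congˡ nv≈ū ⟩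
      ι n⁻¹ K.* (ι p K.- ι q K.* z)      ≈⟨ solve 4 (λ i p q z →
                                              i :* (p :- q :* z) := i :* p :+ (:- (i :* q)) :* z)
                                              K.refl (ι n⁻¹) (ι p) (ι q) z ⟩
      ι n⁻¹ K.* ι p K.+ K.- (ι n⁻¹ K.* ι q) K.* z
        ≈⟨ K.+-cong (K.sym (ι.*-homo n⁻¹ p))
             (K.*-congʳ (K.sym (K.trans (ι.-‿homo _) (K.-‿cong (ι.*-homo n⁻¹ q))))) ⟩
      ι (n⁻¹ k.* p) K.+ ι (k.- (n⁻¹ k.* q)) K.* z ∎)
      where
      n = p k.* p k.- q k.* q k.* w

      nv≈ū : ι n K.* v K.≈ ι p K.- ι q K.* z
      nv≈ū = begin
        ι n K.* v                             ≈⟨ K.*-congʳ (K.trans (ι-norm p q) (K.*-congʳ (K.sym u≈))) ⟩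
        u K.* (ι p K.- ι q K.* z) K.* v       ≈⟨ solve 3 (λ u y v → u :* y :* v := u :* v :* y)
                                                 K.refl u (ι p K.- ι q K.* z) v ⟩
        u K.* v K.* (ι p K.- ι q K.* z)       ≈⟨ K.*-congʳ uv≈1 ⟩
        K.1# K.* (ι p K.- ι q K.* z)          ≈⟨ K.*-identityˡ _ ⟩
        ι p K.- ι q K.* z                     ∎

      -- A zero norm makes the conjugate `n * v` zero; independence then kills `p` and `q`, hence
      -- `u`, against `u * v = 1`.
      n≉0 : ¬ n k.≈ k.0#
      n≉0 n≈0 = 1≉0 K (begin
        K.1#                               ≈⟨ uv≈1 ⟨
        u K.* v                            ≈⟨ K.*-congʳ u≈ ⟩
        (ι p K.+ ι q K.* z) K.* v          ≈⟨ K.*-congʳ (K.+-cong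
                                                (K.trans (ι.⟦⟧-cong p≈0) ι.0#-homo)
                                                (K.trans (K.*-congʳ (K.trans (ι.⟦⟧-cong q≈0) ι.0#-homo))
                                                         (K.zeroˡ z))) ⟩
        (K.0# K.+ K.0#) K.* v              ≈⟨ K.trans (K.*-congʳ (K.+-identityˡ _)) (K.zeroˡ v) ⟩
        K.0#                               ∎)
        where
        p≈0∧-q≈0 : p k.≈ k.0# × k.- q k.≈ k.0#
        p≈0∧-q≈0 = independent (begin
          ι p K.+ ι (k.- q) K.* z   ≈⟨ K.+-congˡ (K.trans (K.*-congʳ (ι.-‿homo q)) (K.sym (K.-‿distribˡ-* _ z))) ⟩
          ι p K.- ι q K.* z         ≈⟨ nv≈ū ⟨
          ι n K.* v                 ≈⟨ K.*-congʳ (K.trans (ι.⟦⟧-cong n≈0) ι.0#-homo) ⟩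
          K.0# K.* v                ≈⟨ K.zeroˡ v ⟩
          K.0#                      ∎)
        p≈0 = proj₁ p≈0∧-q≈0
        q≈0 = k.-‿injective (k.trans (proj₂ p≈0∧-q≈0) (k.sym k.-0#≈0#))

      n⁻¹ = proj₁ (Apartness.inverse k em₂ n≉0)
      nn⁻¹≈1 = proj₂ (Apartness.inverse k em₂ n≉0)

    isIntermediateField : IsIntermediateField k⊆K k⟨z⟩
    isIntermediateField = record
      { respects-≈ = λ { u≈v (p , q , u≈) → p , q , K.trans (K.sym u≈v) u≈ }
      ; contains-F = ι∈k⟨z⟩
      ; +-closed   = λ { (p , q , u≈) (p′ , q′ , v≈) → p k.+ p′ , q k.+ q′ ,
          K.trans (K.+-cong u≈ v≈) (K.trans
            (solve 5 (λ p q p′ q′ z →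
               p :+ q :* z :+ (p′ :+ q′ :* z) := p :+ p′ :+ (q :+ q′) :* z)
             K.refl (ι p) (ι q) (ι p′) (ι q′) z)
            (K.sym (K.+-cong (ι.+-homo p p′) (K.*-congʳ (ι.+-homo q q′))))) }
      ; *-closed   = λ { (p , q , u≈) (p′ , q′ , v≈) →
          p k.* p′ k.+ q k.* q′ k.* w , p k.* q′ k.+ q k.* p′ ,
          K.trans (K.*-cong u≈ v≈) (K.trans
            (solve 5 (λ p q p′ q′ z →
               (p :+ q :* z) :* (p′ :+ q′ :* z) :=
               p :* p′ :+ q :* q′ :* (z :* z) :+ (p :* q′ :+ q :* p′) :* z)
             K.refl (ι p) (ι q) (ι p′) (ι q′) z)
            (K.sym (K.+-cong
              (K.trans (ι.+-homo _ _) (K.+-cong (ι.*-homo p p′)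
                (K.trans (ι.*-homo _ w) (K.*-cong (ι.*-homo q q′) (K.sym z²≈w)))))
              (K.*-congʳ (K.trans (ι.+-homo _ _) (K.+-cong (ι.*-homo p q′) (ι.*-homo q p′))))))) }
      ; neg-closed = λ { (p , q , u≈) → k.- p , k.- q ,
          K.trans (K.-‿cong u≈) (K.trans
            (solve 3 (λ p q z → :- (p :+ q :* z) := :- p :+ (:- q) :* z) K.refl (ι p) (ι q) z)
            (K.sym (K.+-cong (ι.-‿homo p) (K.*-congʳ (ι.-‿homo q))))) }
      ; inv-closed = inverse∈k⟨z⟩
      }

    quadratic : HasDimension k⊆K k⟨z⟩ 2
    quadratic = K.1# ∷ z ∷ [] , record
      { member      = λ
        { 0F → k.1# , k.0# , K.sym (K.trans (K.+-cong ι.1#-homo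
                 (K.trans (K.*-congʳ ι.0#-homo) (K.zeroˡ z))) (K.+-identityʳ _))
        ; 1F → z∈k⟨z⟩ }
      ; spanning    = λ { (p , q , u≈) → p ∷ q ∷ [] ,
                          K.trans u≈ (K.sym (combination≈ (p ∷ q ∷ []))) }
      ; independent = λ s s≈0 → let p≈0 , q≈0 = independent (K.trans (K.sym (combination≈ s)) s≈0) in
                          λ { 0F → p≈0 ; 1F → q≈0 }
      }
      where
      combination≈ : ∀ s → combination k⊆K s (K.1# ∷ z ∷ []) K.≈ ι (s 0F) K.+ ι (s 1F) K.* z
      combination≈ s = K.+-cong (K.*-identityʳ _) (K.+-identityʳ _)

  -- A root of X² - u, with coefficients listed from the constant term up. The long sum in the
  -- calculation is `evaluate` unfolded at `z`.
  √-exists : IsAlgebraicClosure k⊆K → ∀ u → ∃ λ z → z K.* z K.≈ u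
  √-exists closure u =
    let z , eq = IsAlgebraicClosure.closed closure (K.- u ∷ K.0# ∷ K.1# ∷ [])
                   (HeytingProperties.1#0 (HeytingField.heytingCommutativeRing K)) in
    z , K.sym (K.trans (K.sym (K.+-identityʳ u)) (K.trans (K.+-congˡ (K.sym eq)) (begin
      u K.+ (K.- u K.* K.1# K.+ (K.0# K.* (z K.* K.1#) K.+ (K.1# K.* (z K.* (z K.* K.1#)) K.+ K.0#)))
        ≈⟨ K.+-congˡ (K.+-cong (K.*-identityʳ _) (K.+-cong (K.zeroˡ _)
             (K.trans (K.+-identityʳ _) (K.trans (K.*-identityˡ _) (K.*-congˡ (K.*-identityʳ z)))))) ⟩
      u K.+ (K.- u K.+ (K.0# K.+ z K.* z))
        ≈⟨ K.trans (K.sym (K.+-assoc _ _ _)) (K.+-cong (K.-‿inverseʳ u) (K.+-identityˡ _)) ⟩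
      K.0# K.+ z K.* z
        ≈⟨ K.+-identityˡ _ ⟩
      z K.* z ∎)))

  quadraticPoint : ExcludedMiddle (κ ⊔ ℓ₁ ⊔ ℓ₂) → IsNumberField k → IsAlgebraicClosure k⊆K →
    ∀ f x → ∃ λ z → Curve.Γ₂ k⊆K f (Curve.[_,1,_] (ι x) z)
  quadraticPoint em nf closure f x with Image-value f (Image-ι x) Image-1#
  ... | v , value≈v with lowerExcludedMiddle ℓ₂ em {IsSquare k v}
  ...   | no ¬square =
    let z , z²≈v = √-exists closure (ι v)
        open QuadraticExtension (IsNumberField.ℚ⊆k nf) (lowerExcludedMiddle (κ ⊔ ℓ₂) em)
               (lowerExcludedMiddle (κ ⊔ ℓ₁) em) ¬square z²≈v in
    z , record
      { L                   = k⟨z⟩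
      ; isIntermediateField = isIntermediateField
      ; quadratic           = quadratic
      ; P∈C⟨L⟩              = record
        { x∈L     = ι∈k⟨z⟩ x
        ; z∈L     = z∈k⟨z⟩
        ; onCurve = K.trans (K.*-congˡ (K.*-identityʳ z)) (K.trans z²≈v (K.sym value≈v))
        }
      }
  ...   | yes (s , s²≈v) =
    -- The point is already rational over `k`, but a field of degree exactly 2 is demanded. Here `w`
    -- and `z` have nothing to do with the curve and only provide such a field.
    let w , ¬square = nonSquare k (lowerExcludedMiddle ℓ₂ em) nf
        z , z²≈w = √-exists closure (ι w)
        open QuadraticExtension (IsNumberField.ℚ⊆k nf) (lowerExcludedMiddle (κ ⊔ ℓ₂) em)
               (lowerExcludedMiddle (κ ⊔ ℓ₁) em) ¬square z²≈w in
    ι s , record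
      { L                   = k⟨z⟩
      ; isIntermediateField = isIntermediateField
      ; quadratic           = quadratic
      ; P∈C⟨L⟩              = record
        { x∈L     = ι∈k⟨z⟩ x
        ; z∈L     = ι∈k⟨z⟩ s
        ; onCurve = K.trans (K.*-congˡ (K.*-identityʳ (ι s))) (K.trans (K.sym (ι.*-homo s s))
                      (K.trans (ι.⟦⟧-cong s²≈v) (K.sym value≈v)))
        }
      }

-- Distinct abscissas and the two progressions

2^-injective : ∀ {m n} → 2 ℕ.^ m ≡ 2 ℕ.^ n → m ≡ n
2^-injective {m} {n} eq with ℕ.<-cmp m n
... | tri< m<n _ _ = contradiction eq (ℕ.<⇒≢ (ℕ.^-monoʳ-< 2 (s≤s (s≤s z≤n)) m<n))
... | tri≈ _ m≡n _ = m≡n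
... | tri> _ _ n<m = contradiction (≡.sym eq) (ℕ.<⇒≢ (ℕ.^-monoʳ-< 2 (s≤s (s≤s z≤n)) n<m))

module _ (k : HeytingField κ ℓ₁ ℓ₂) (ℚ⊆k : Extension ℚ-field k) where
  open CommutativeRing (commutativeRing k) hiding (zero)
  open CharacteristicZero k ℚ⊆k
  open RingMorphisms.IsRingHomomorphism ⟦⟧-isRingHomomorphism
  open FieldOps k using (_^_; _·_)

  -- Otherwise the nonzero integer `x - y` would annihilate 1, against torsion-freeness.
  ⟦⟧-injective : ∀ {x y} → ⟦ x ⟧ ≈ ⟦ y ⟧ → x ≡ y
  ⟦⟧-injective {x} {y} eq = decidable-stable (x ℤ.≟ y) λ x≢y →
    1≉0 k (⟦⟧-torsionFree (x≢y ∘ ℤ.i-j≡0⇒i≡j x y) (trans (*-identityʳ _)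
      (trans (+-homo x (ℤ.- y)) (trans (+-cong eq (-‿homo y)) (-‿inverseʳ _)))))

  ⟦2⟧^ : ∀ n → ⟦ + 2 ⟧ ^ n ≈ ⟦ + (2 ℕ.^ n) ⟧
  ⟦2⟧^ zero    = sym 1#-homo
  ⟦2⟧^ (suc n) = trans (*-congˡ (⟦2⟧^ n)) (trans (sym (*-homo (+ 2) (+ (2 ℕ.^ n))))
    (⟦⟧-cong (≡.sym (ℤ.pos-* 2 (2 ℕ.^ n)))))

  ·1≈⟦⟧ : ∀ n → n · 1# ≈ ⟦ + n ⟧
  ·1≈⟦⟧ zero    = sym 0#-homo
  ·1≈⟦⟧ (suc n) = trans (+-cong (sym 1#-homo) (·1≈⟦⟧ n)) (sym (+-homo 1ℤ (+ n)))

lemma4p2 : ∀ {c ℓ₁ ℓ₂} → ExcludedMiddle (c ⊔ ℓ₁ ⊔ ℓ₂) →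
    (k K : HeytingField c ℓ₁ ℓ₂) (k⊆K : Extension k K) →
    IsNumberField k → IsAlgebraicClosure k⊆K →
    (f : Polynomial₂ k) (d : ℕ) → 2 ≤ d → IsHomogeneousOfDegree d f →
    let open Curve k⊆K f in
    (∃ λ P → IsQuadraticGeometricProgression P × Infinite P) ×
    (∃ λ P → IsQuadraticArithmeticProgression P × Infinite P)
lemma4p2 {c} {ℓ₁} {ℓ₂} em k K k⊆K nf closure f _ _ _ =
  (points geometric , record
    { quadraticPoint = points-quadratic geometric
    ; x∈k            = λ n → geometric n , K.refl
    ; t              = ⟦ + 2 ⟧
    ; t′             = ⟦ + 2 ⟧
    ; t#0            = 2#0
    ; t′#0           = 2#0
    ; progression    = λ n → K.refl
    } , points-infinite geometric λ {m} {n} eq →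
      -- The abscissa with index `n` unfolds to 2 to the power n + 2: one step comes from the factor
      -- `t′`, one from counting from 1.
      ℕ.suc-injective (ℕ.suc-injective (2^-injective (ℤ.+-injective (⟦⟧-injective k ℚ⊆k
        (trans (sym (⟦2⟧^ k ℚ⊆k (2 ℕ.+ m))) (trans eq (⟦2⟧^ k ℚ⊆k (2 ℕ.+ n))))))))) ,
  (points arithmetic , record
    { quadraticPoint = points-quadratic arithmetic
    ; x∈k            = λ n → arithmetic n , K.refl
    ; t              = 1#
    ; t′             = 1#
    ; t#0            = 1#0
    ; t′#0           = 1#0
    ; progression    = λ n → K.refl
    } , points-infinite arithmetic λ {m} {n} eq →
      -- Likewise `1# + suc n · 1#` unfolds to `(2 + n) · 1#`.
      ℕ.suc-injective (ℕ.suc-injective (ℤ.+-injective (⟦⟧-injective k ℚ⊆k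
        (trans (sym (·1≈⟦⟧ k ℚ⊆k (2 ℕ.+ m))) (trans eq (·1≈⟦⟧ k ℚ⊆k (2 ℕ.+ n))))))))
  where
  open Curve k⊆K f
  open IsNumberField nf using (ℚ⊆k)
  open CharacteristicZero k ℚ⊆k
  open FieldOps k using (_^_; _·_)
  open HeytingField k using (_#_)
  open CommutativeRing (commutativeRing k) hiding (zero)
  open HeytingProperties (HeytingField.heytingCommutativeRing k) using (1#0)
  open Extension k⊆K using (ι)
  module K = CommutativeRing (commutativeRing K)

  geometric arithmetic : ℕ → Carrier
  geometric n = ⟦ + 2 ⟧ * ⟦ + 2 ⟧ ^ suc n
  arithmetic n = 1# + suc n · 1#

  2#0 : ⟦ + 2 ⟧ # 0#
  2#0 = Apartness.≉⇒# k (lowerExcludedMiddle (c ⊔ ℓ₁) em) λ 2≈0 →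
    1≉0 k (⟦⟧-torsionFree {+ 2} (λ ()) (trans (*-identityʳ _) 2≈0))

  points : (ℕ → Carrier) → ℕ → Point
  points x n = [ ι (x n) ,1, proj₁ (quadraticPoint k⊆K em nf closure f (x n)) ]

  points-quadratic : ∀ x n → Γ₂ (points x n)
  points-quadratic x n = proj₂ (quadraticPoint k⊆K em nf closure f (x n))

  points-infinite : ∀ x → (∀ {m n} → x m ≈ x n → m ≡ n) → Infinite (points x)
  -- The first `m` terms are chosen; their abscissas alone tell them apart, whatever square roots
  -- were taken.
  points-infinite x x-injective m = toℕ , λ (x≈ , _) →
    Fin.toℕ-injective (x-injective (ι-injective k⊆K x≈))
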